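{- Let $S_n=\sum_{k=0}^n\binom{n}{k}^2\binom{2k}{k}(2k+1)$ for $n=0,1,2,\ldots$. Then the sequence $\{S_{n+1}/S_n\}_{n\geq 3}$ is strictly increasing with limit $9$, and the sequence $\{\sqrt[n+1]{S_{n+1}}/\sqrt[n]{S_n}\}_{n\geq 1}$ is strictly decreasing with limit $1$.
   Context: $S_n$ is a sequence of positive integers (e.g. $S_0=1$, $S_1=7$, $S_2=55$, $S_3=465$). -}

module Defs where

open import Data.Nat as ℕ using (ℕ; zero; suc; _+_; _*_; _^_; NonZero)
open import Data.Nat.Properties using (m≤m+n; ≤-trans)
open import Data.Nat.Combinatorics using (_C_)
open import Data.Integer using (+_)
open import Data.Rational as ℚ using (ℚ; 1ℚ; _/_)
open import Data.Sum using (_⊎_)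
open import Data.Product using (_×_)

sumUpTo : (ℕ → ℕ) → ℕ → ℕ
sumUpTo f zero    = f 0
sumUpTo f (suc n) = sumUpTo f n + f (suc n)

S : ℕ → ℕ
S n = sumUpTo (λ k → (n C k) ^ 2 * ((2 * k) C k) * (2 * k + 1)) n

sumUpTo-≥-f0 : ∀ f n → f 0 ℕ.≤ sumUpTo f n
sumUpTo-≥-f0 f zero    = Data.Nat.Properties.≤-refl
sumUpTo-≥-f0 f (suc n) = ≤-trans (sumUpTo-≥-f0 f n) (m≤m+n _ _)

S-pos : ∀ n → 1 ℕ.≤ S n
S-pos n = sumUpTo-≥-f0 (λ k → (n C k) ^ 2 * ((2 * k) C k) * (2 * k + 1)) n

S-nonZero : ∀ n → NonZero (S n)
S-nonZero n = ℕ.>-nonZero (S-pos n)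

ratio : ℕ → ℚ
ratio n = _/_ (+ S (suc n)) (S n) {{S-nonZero n}}

_^ℚ_ : ℚ → ℕ → ℚ
q ^ℚ zero  = 1ℚ
q ^ℚ suc m = q ℚ.* (q ^ℚ m)

-- a n := S(n+1)^{1/(n+1)} / S(n)^{1/n}   (n ≥ 1), a positive real.
-- Since ℚ has no roots, comparisons of a n with a rational c are expressed
-- by raising both (positive) sides to the power n(n+1):
--   a n < c  ⇔  0 < c  and  S(n+1)^n < c^{n(n+1)} · S(n)^{n+1}
--   c < a n  ⇔  c ≤ 0  or   c^{n(n+1)} · S(n)^{n+1} < S(n+1)^n
rootRatio< : ℕ → ℚ → Set
rootRatio< n c = (0ℚ' ℚ.< c) × ((+ (S (suc n) ^ n)) / 1 ℚ.< (c ^ℚ (n * suc n)) ℚ.* ((+ (S n ^ suc n)) / 1))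
  where 0ℚ' = ℚ.0ℚ

_<rootRatio_ : ℚ → ℕ → Set
c <rootRatio n = (c ℚ.≤ ℚ.0ℚ) ⊎ ((c ^ℚ (n * suc n)) ℚ.* ((+ (S n ^ suc n)) / 1) ℚ.< (+ (S (suc n) ^ n)) / 1)

-- a (n+1) < a n, after raising both sides to the power n(n+1)(n+2):
--   S(n+2)^{n(n+1)} · S(n)^{(n+1)(n+2)} < S(n+1)^{2n(n+2)}
rootRatioDecreasingAt : ℕ → Set
rootRatioDecreasingAt n =
  S (suc (suc n)) ^ (n * suc n) * S n ^ (suc n * suc (suc n)) ℕ.< S (suc n) ^ (2 * n * suc (suc n))

{-# OPTIONS --safe #-}

-- With g(n) = Σ C(n,k)² C(2k,k), the sum Σ (3k − 2n) C(n,k)² C(2k,k) telescopes to a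
-- quantity independent of n, hence vanishes; this says 3 S(n) = (4n + 3) g(n).
-- Zeilberger's recurrence for g then gives a three-term recurrence for S, from which
--     b(n) ≤ S(n+1)/S(n) < b(n+1),   b(n) = 9 (1 − 2/(2n+1)²),   n ≥ 1,
-- follows by induction.  Monotonicity of the ratios and their limit 9 are immediate.
-- For the roots, S(n+2) < 9 S(n+1) reduces the claim to
--     9^(n(n+1)) S(n)² < (S(n+1)/S(n))^(n(n+3)),
-- which Bernoulli's inequality applied to b(n)^(n(n+3)) yields from S(n) ≤ (3/5) 9^n
-- (n ≥ 6).  The limit 1 only needs S(n) ≤ 9^n and S(n) < S(n+1) < 9 S(n).

module Submission where

open import Defs
open import Algebra.Bundles using (CommutativeMonoid)
open import Data.Bool using (T)
open import Data.Empty using (⊥)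
open import Data.Integer as ℤ using (ℤ; +_; -[1+_])
import Data.Integer.Properties as ℤ
import Data.Integer.Tactic.RingSolver as ℤ-Solver
open import Data.List using (List; []; _∷_; map)
open import Data.Nat as ℕ using (ℕ; zero; suc; _≥_)
open import Data.Nat.Combinatorics using (_C_; nCk+nC[k+1]≡[n+1]C[k+1]; k>n⇒nCk≡0; nC1≡n)
import Data.Nat.Properties as ℕ
import Data.Nat.Tactic.RingSolver as ℕ-Solver
open import Data.Product using (_×_; _,_; ∃-syntax)
import Data.Rational.Properties as ℚ
open import Data.Rational.Solver using (module +-*-Solver)
open import Data.Rational.Unnormalised as ℚᵘ using (mkℚᵘ; *≡*; *≤*; *<*)
import Data.Rational.Unnormalised.Properties as ℚᵘ
open import Data.Sum using (inj₁; inj₂)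
open import Data.Unit using (⊤)
open import Relation.Binary.PropositionalEquality
open import Relation.Nullary using (Dec; yes; no)
open import Relation.Nullary.Decidable using (toWitness)
open import Algebra.Properties.CommutativeSemigroup
  (CommutativeMonoid.commutativeSemigroup ℚ.*-1-commutativeMonoid) using (interchange; xy∙z≈xz∙y)

-- The point of b is interlacing: b(n+1) is the upper bound at n and also the lower bound at n + 1,
-- so it separates consecutive ratios. For the roots the deficit 2/(2n+1)^2 is met with an exponent
-- of order n^2, so it does not fade out. Bernoulli leaves 1 - 2n(n+3)/(2n+1)^2, which tends to 1/2
-- and has to beat the square of S(n)/9^n. The bound S(n) ≤ 9^n is therefore too weak; 3/5 serves
-- because (3/5)^2 = 9/25 lies below 1/2. The index 6 is the first n with S(n)/9^n ≤ 3/5, and also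
-- the first positive n at which Bernoulli's remainder exceeds 9/25. The cases below 6 are settled
-- by evaluation.

module _ where
  open import Data.Integer using (_+_; _*_; _-_; -_)
  open ≡-Reasoning

  -- Absorption identities for binomial coefficients

  binom : ℕ → ℕ → ℤ
  binom n k = + (n C k)

  pascal : ∀ n k → binom (suc n) (suc k) ≡ binom n k + binom n (suc k)
  pascal n k = cong +_ (sym (nCk+nC[k+1]≡[n+1]C[k+1] n k))

  -- Over the integers n - k keeps its value for k > n, where both sides vanish, so the later
  -- polynomial identities need no side condition k ≤ n.
  absorb-lower : ∀ n k → + suc k * binom n (suc k) ≡ (+ n - + k) * binom n k
  absorb-lower zero zero = refl
  absorb-lower zero (suc k) = begin
    + suc (suc k) * binom 0 (suc (suc k)) ≡⟨ cong (λ x → + suc (suc k) * + x) (k>n⇒nCk≡0 {0} {suc (suc k)} (ℕ.s≤s ℕ.z≤n)) ⟩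
    + suc (suc k) * + 0               ≡⟨ ℤ.*-zeroʳ (+ suc (suc k)) ⟩
    + 0                               ≡⟨ ℤ.*-zeroʳ (+ 0 - + suc k) ⟨
    (+ 0 - + suc k) * + 0             ≡⟨ cong (λ x → (+ 0 - + suc k) * + x) (k>n⇒nCk≡0 {0} {suc k} (ℕ.s≤s ℕ.z≤n)) ⟨
    (+ 0 - + suc k) * binom 0 (suc k)     ∎
  absorb-lower (suc n) zero = begin
    + 1 * binom (suc n) 1       ≡⟨ ℤ.*-identityˡ _ ⟩
    binom (suc n) 1             ≡⟨ cong +_ (nC1≡n (suc n)) ⟩
    + suc n                 ≡⟨ ℤ.+-identityʳ _ ⟨
    + suc n - + 0           ≡⟨ ℤ.*-identityʳ _ ⟨
    (+ suc n - + 0) * + 1   ∎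
  absorb-lower (suc n) (suc k) = begin
    + suc (suc k) * binom (suc n) (suc (suc k))               ≡⟨ cong (+ suc (suc k) *_) (pascal n (suc k)) ⟩
    + suc (suc k) * (binom n (suc k) + binom n (suc (suc k)))     ≡⟨ ℤ.*-distribˡ-+ (+ suc (suc k)) (binom n (suc k)) _ ⟩
    + suc (suc k) * binom n (suc k) + + suc (suc k) * binom n (suc (suc k))  ≡⟨ cong (λ x → + suc (suc k) * binom n (suc k) + x) (absorb-lower n (suc k)) ⟩
    (+ 1 + + suc k) * binom n (suc k) + (+ n - + suc k) * binom n (suc k)       ≡⟨ ring₁ (+ n) (+ suc k) (binom n (suc k)) ⟩
    + suc k * binom n (suc k) + (+ 1 + + n - + suc k) * binom n (suc k)         ≡⟨ cong (λ x → x + (+ suc n - + suc k) * binom n (suc k)) (absorb-lower n k) ⟩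
    (+ n - + k) * binom n k + (+ 1 + + n - (+ 1 + + k)) * binom n (suc k)       ≡⟨ ring₂ (+ n) (+ k) (binom n k) (binom n (suc k)) ⟩
    (+ suc n - + suc k) * (binom n k + binom n (suc k))           ≡⟨ cong ((+ suc n - + suc k) *_) (pascal n k) ⟨
    (+ suc n - + suc k) * binom (suc n) (suc k)               ∎
    where
    ring₁ : ∀ n k x → (+ 1 + k) * x + (n - k) * x ≡ k * x + (+ 1 + n - k) * x
    ring₁ = ℤ-Solver.solve-∀
    ring₂ : ∀ n k x y → (n - k) * x + (+ 1 + n - (+ 1 + k)) * y ≡ (+ 1 + n - (+ 1 + k)) * (x + y)
    ring₂ = ℤ-Solver.solve-∀

  absorb-upper : ∀ n k → (+ suc n - + k) * binom (suc n) k ≡ + suc n * binom n k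
  absorb-upper n zero = cong (_* + 1) (ℤ.+-identityʳ (+ suc n))
  absorb-upper n (suc k) = begin
    (+ suc n - + suc k) * binom (suc n) (suc k)                        ≡⟨ cong ((+ suc n - + suc k) *_) (pascal n k) ⟩
    (+ 1 + + n - (+ 1 + + k)) * (binom n k + binom n (suc k))              ≡⟨ ring₁ (+ n) (+ k) (binom n k) (binom n (suc k)) ⟩
    (+ n - + k) * binom n k + (+ n - + k) * binom n (suc k)                ≡⟨ cong (λ x → x + (+ n - + k) * binom n (suc k)) (absorb-lower n k) ⟨
    (+ 1 + + k) * binom n (suc k) + (+ n - + k) * binom n (suc k)          ≡⟨ ring₂ (+ n) (+ k) (binom n (suc k)) ⟩
    + suc n * binom n (suc k)                                          ∎
    where
    ring₁ : ∀ n k x y → (+ 1 + n - (+ 1 + k)) * (x + y) ≡ (n - k) * x + (n - k) * y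
    ring₁ = ℤ-Solver.solve-∀
    ring₂ : ∀ n k x → (+ 1 + k) * x + (n - k) * x ≡ (+ 1 + n) * x
    ring₂ = ℤ-Solver.solve-∀

  central-step : ∀ k → + suc k * binom (2 ℕ.* suc k) (suc k) ≡ + 2 * (+ 2 * + k + + 1) * binom (2 ℕ.* k) k
  -- Of the two factors k + 1, one is read as 2k + 2 - (k + 1) for `absorb-upper`; the spare one
  -- feeds `absorb-lower` once Pascal's rule has split the coefficient.
  central-step k = ℤ.*-cancelˡ-≡ (+ suc k) _ _ (begin
    + suc k * (+ suc k * binom (2 ℕ.* suc k) (suc k))
      ≡⟨ cong (λ m → + suc k * (+ suc k * binom m (suc k))) 2[1+k] ⟩
    (+ 1 + + k) * ((+ 1 + + k) * binom (2 ℕ.+ n) (suc k))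
      ≡⟨ cong (λ x → + suc k * (x * binom (2 ℕ.+ n) (suc k))) difference ⟨
    + suc k * ((+ (2 ℕ.+ n) - + suc k) * binom (2 ℕ.+ n) (suc k))
      ≡⟨ cong (+ suc k *_) (absorb-upper (suc n) (suc k)) ⟩
    + suc k * (+ (2 ℕ.+ n) * binom (suc n) (suc k))
      ≡⟨ cong (λ x → + suc k * (+ (2 ℕ.+ n) * x)) (pascal n k) ⟩
    + suc k * (+ (2 ℕ.+ n) * (binom n k + binom n (suc k)))
      ≡⟨ cong (λ x → + suc k * ((+ 2 + x) * (binom n k + binom n (suc k)))) (ℤ.pos-* 2 k) ⟩
    (+ 1 + + k) * ((+ 2 + + 2 * + k) * (binom n k + binom n (suc k)))
      ≡⟨ ring₁ (+ k) (binom n k) (binom n (suc k)) ⟩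
    (+ 2 + + 2 * + k) * ((+ 1 + + k) * binom n k + + suc k * binom n (suc k))
      ≡⟨ cong (λ x → (+ 2 + + 2 * + k) * ((+ 1 + + k) * binom n k + x)) (absorb-lower n k) ⟩
    (+ 2 + + 2 * + k) * ((+ 1 + + k) * binom n k + (+ n - + k) * binom n k)
      ≡⟨ cong (λ x → (+ 2 + + 2 * + k) * ((+ 1 + + k) * binom n k + (x - + k) * binom n k)) (ℤ.pos-* 2 k) ⟩
    (+ 2 + + 2 * + k) * ((+ 1 + + k) * binom n k + (+ 2 * + k - + k) * binom n k)
      ≡⟨ ring₂ (+ k) (binom n k) ⟩
    + suc k * (+ 2 * (+ 2 * + k + + 1) * binom n k) ∎)
    where
    n = 2 ℕ.* k
    2[1+k] : 2 ℕ.* suc k ≡ 2 ℕ.+ n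
    2[1+k] = ℕ.*-suc 2 k
    ring₀ : ∀ k → + 2 + + 2 * k - (+ 1 + k) ≡ + 1 + k
    ring₀ = ℤ-Solver.solve-∀
    difference : + (2 ℕ.+ n) - + suc k ≡ + suc k
    difference = trans (cong (λ x → + 2 + x - + suc k) (ℤ.pos-* 2 k)) (ring₀ (+ k))
    ring₁ : ∀ k x y → (+ 1 + k) * ((+ 2 + + 2 * k) * (x + y)) ≡ (+ 2 + + 2 * k) * ((+ 1 + k) * x + (+ 1 + k) * y)
    ring₁ = ℤ-Solver.solve-∀
    ring₂ : ∀ k x → (+ 2 + + 2 * k) * ((+ 1 + k) * x + (+ 2 * k - k) * x) ≡ (+ 1 + k) * (+ 2 * (+ 2 * k + + 1) * x)
    ring₂ = ℤ-Solver.solve-∀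

  -- The hypergeometric term and finite sums

  central : ℕ → ℤ
  central k = binom (2 ℕ.* k) k

  w : ℕ → ℕ → ℤ
  w n k = binom n k * binom n k * central k

  -- The term ratio in k with its denominator cleared: two factors come from the squared binomial
  -- and one from the central one.
  w-step : ∀ n k → let K = + suc k in
    K * K * K * w n (suc k) ≡ + 2 * (+ 2 * + k + + 1) * ((+ n - + k) * (+ n - + k)) * w n k
  w-step n k = begin
    K * K * K * (x′ * x′ * e′)           ≡⟨ ring₁ K x′ e′ ⟩
    (K * x′) * (K * x′) * (K * e′)       ≡⟨ cong₂ (λ s t → s * s * t) (absorb-lower n k) (central-step k) ⟩
    (d * x) * (d * x) * (t * e)          ≡⟨ ring₂ d x t e ⟩
    t * (d * d) * (x * x * e)            ∎
    where
    K = + suc k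
    x′ = binom n (suc k)
    e′ = central (suc k)
    x = binom n k
    e = central k
    d = + n - + k
    t = + 2 * (+ 2 * + k + + 1)
    ring₁ : ∀ K x e → K * K * K * (x * x * e) ≡ (K * x) * (K * x) * (K * e)
    ring₁ = ℤ-Solver.solve-∀
    ring₂ : ∀ d x t e → (d * x) * (d * x) * (t * e) ≡ t * (d * d) * (x * x * e)
    ring₂ = ℤ-Solver.solve-∀

  -- Lets the summands of different rows be written as polynomial multiples of one and the same
  -- term.
  w-lift : ∀ n k → let d = + suc n - + k in
    + suc n * + suc n * w n k ≡ d * d * w (suc n) k
  w-lift n k = begin
    N * N * (x * x * e)      ≡⟨ ring₁ N x e ⟩
    (N * x) * (N * x) * e    ≡⟨ cong (λ y → y * y * e) (absorb-upper n k) ⟨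
    (d * y) * (d * y) * e    ≡⟨ ring₁ d y e ⟨
    d * d * (y * y * e)      ∎
    where
    N = + suc n
    x = binom n k
    y = binom (suc n) k
    d = + suc n - + k
    e = central k
    ring₁ : ∀ N x e → N * N * (x * x * e) ≡ (N * x) * (N * x) * e
    ring₁ = ℤ-Solver.solve-∀

  w-vanishes : ∀ {n k} → n ℕ.< k → w n k ≡ + 0
  w-vanishes {n} {k} n<k rewrite k>n⇒nCk≡0 n<k = refl

  sumℤ : (ℕ → ℤ) → ℕ → ℤ
  sumℤ f zero    = f 0
  sumℤ f (suc m) = sumℤ f m + f (suc m)

  sumℤ-cong : ∀ {f g} → (∀ k → f k ≡ g k) → ∀ m → sumℤ f m ≡ sumℤ g m
  sumℤ-cong f≗g zero    = f≗g 0
  sumℤ-cong f≗g (suc m) = cong₂ _+_ (sumℤ-cong f≗g m) (f≗g (suc m))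

  sumℤ-linear : ∀ a b f g m → sumℤ (λ k → a * f k + b * g k) m ≡ a * sumℤ f m + b * sumℤ g m
  sumℤ-linear a b f g zero    = refl
  sumℤ-linear a b f g (suc m) =
    trans (cong (λ x → x + (a * f (suc m) + b * g (suc m))) (sumℤ-linear a b f g m))
          (ring a b (sumℤ f m) (sumℤ g m) (f (suc m)) (g (suc m)))
    where
    ring : ∀ a b F G x y → a * F + b * G + (a * x + b * y) ≡ a * (F + x) + b * (G + y)
    ring = ℤ-Solver.solve-∀

  sumℤ-*ˡ : ∀ a f m → sumℤ (λ k → a * f k) m ≡ a * sumℤ f m
  sumℤ-*ˡ a f zero    = refl
  sumℤ-*ˡ a f (suc m) = trans (cong (λ x → x + a * f (suc m)) (sumℤ-*ˡ a f m)) (sym (ℤ.*-distribˡ-+ a _ _))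

  sumℤ-telescope : ∀ (G : ℕ → ℤ) m → sumℤ (λ k → G (suc k) - G k) m ≡ G (suc m) - G 0
  sumℤ-telescope G zero    = refl
  sumℤ-telescope G (suc m) =
    trans (cong (λ x → x + (G (suc (suc m)) - G (suc m))) (sumℤ-telescope G m)) (ring (G 0) (G (suc m)) (G (suc (suc m))))
    where
    ring : ∀ x y z → y - x + (z - y) ≡ z - x
    ring = ℤ-Solver.solve-∀

  sumℤ-extend : ∀ f m → f (suc m) ≡ + 0 → sumℤ f (suc m) ≡ sumℤ f m
  sumℤ-extend f m eq = trans (cong (λ x → sumℤ f m + x) eq) (ℤ.+-identityʳ _)

  pos-sumUpTo : ∀ f m → + sumUpTo f m ≡ sumℤ (λ k → + f k) m
  pos-sumUpTo f zero    = refl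
  pos-sumUpTo f (suc m) = cong (λ x → x + + f (suc m)) (pos-sumUpTo f m)

  -- x is the polynomial solution produced by the algorithm of Gosper.
  module Certificate (n : ℕ) (x : ℕ → ℤ) where

    G : ℕ → ℤ
    G k = + k * + k * + k * w n k * x k

    -- The factor k^3 in `G` is the denominator in `w-step`, so `G (suc k)` turns into a multiple of
    -- `w n k`.
    difference : ∀ k → let d = + n - + k in
      (+ 2 * (+ 2 * + k + + 1) * (d * d) * x (suc k) - + k * + k * + k * x k) * w n k ≡ G (suc k) - G k
    difference k = begin
      (t * x (suc k) - K³ * x k) * w n k           ≡⟨ ring t (x (suc k)) K³ (x k) (w n k) ⟩
      t * w n k * x (suc k) - K³ * w n k * x k     ≡⟨ cong (λ s → s * x (suc k) - G k) (w-step n k) ⟨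
      G (suc k) - G k                              ∎
      where
      d = + n - + k
      t = + 2 * (+ 2 * + k + + 1) * (d * d)
      K³ = + k * + k * + k
      ring : ∀ t x K y w → (t * x - K * y) * w ≡ t * w * x - K * w * y
      ring = ℤ-Solver.solve-∀

    -- Both ends vanish: `G 0` by its factor k^3, and `G (suc n)` because `w n (suc n)` is zero.
    sum≡0 : sumℤ (λ k → G (suc k) - G k) n ≡ + 0
    sum≡0 = begin
      sumℤ (λ k → G (suc k) - G k) n ≡⟨ sumℤ-telescope G n ⟩
      G (suc n) - G 0                ≡⟨ cong (λ y → K³ * y * x (suc n) - G 0) (w-vanishes (ℕ.n<1+n n)) ⟩
      K³ * + 0 * x (suc n) - + 0     ≡⟨ ring K³ (x (suc n)) ⟩
      + 0                            ∎
      where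
      K³ = + suc n * + suc n * + suc n
      ring : ∀ t x → t * + 0 * x - + 0 ≡ + 0
      ring = ℤ-Solver.solve-∀

  -- The vanishing moment and the reduction of S to g

  moment : ℕ → ℤ
  moment n = sumℤ (λ k → (+ 3 * + k - + 2 * + n) * w n k) n

  -- What telescopes is the difference of consecutive moments: multiplied by (n+1)^2, both are
  -- expressed in row n + 1, where the constant certificate 1 works.
  moment-suc : ∀ n → moment (suc n) ≡ moment n
  moment-suc n = sym (ℤ.*-cancelˡ-≡ (N * N) (moment n) (moment (suc n)) (begin
    N * N * moment n              ≡⟨ ring₀ (N * N) (moment n) (moment (suc n)) ⟩
    N * N * moment n + - (N * N) * moment (suc n) + N * N * moment (suc n)
      ≡⟨ cong (λ x → x + N * N * moment (suc n)) zero-sum ⟩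
    + 0 + N * N * moment (suc n)  ≡⟨ ℤ.+-identityˡ _ ⟩
    N * N * moment (suc n)        ∎))
    where
    N = + suc n
    open Certificate (suc n) (λ _ → + 1)
    f₀ f₁ : ℕ → ℤ
    f₀ k = (+ 3 * + k - + 2 * + n) * w n k
    f₁ k = (+ 3 * + k - + 2 * N) * w (suc n) k
    ring₀ : ∀ a x y → a * x ≡ a * x + - a * y + a * y
    ring₀ = ℤ-Solver.solve-∀
    ring₁ : ∀ n k u v → let N = + 1 + n in
      N * N * ((+ 3 * k - + 2 * n) * u) + - (N * N) * ((+ 3 * k - + 2 * N) * v)
      ≡ (+ 3 * k - + 2 * n) * (N * N * u) - (N * N) * ((+ 3 * k - + 2 * N) * v)
    ring₁ = ℤ-Solver.solve-∀
    ring₂ : ∀ n k v → let N = + 1 + n; d = N - k in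
      (+ 3 * k - + 2 * n) * (d * d * v) - (N * N) * ((+ 3 * k - + 2 * N) * v)
      ≡ (+ 2 * (+ 2 * k + + 1) * (d * d) * + 1 - k * k * k * + 1) * v
    ring₂ = ℤ-Solver.solve-∀
    termwise : ∀ k → N * N * f₀ k + - (N * N) * f₁ k ≡ G (suc k) - G k
    termwise k = begin
      N * N * f₀ k + - (N * N) * f₁ k
        ≡⟨ ring₁ (+ n) (+ k) (w n k) (w (suc n) k) ⟩
      (+ 3 * + k - + 2 * + n) * (N * N * w n k) - N * N * f₁ k
        ≡⟨ cong (λ y → (+ 3 * + k - + 2 * + n) * y - N * N * f₁ k) (w-lift n k) ⟩
      (+ 3 * + k - + 2 * + n) * ((N - + k) * (N - + k) * w (suc n) k) - N * N * f₁ k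
        ≡⟨ ring₂ (+ n) (+ k) (w (suc n) k) ⟩
      (+ 2 * (+ 2 * + k + + 1) * ((N - + k) * (N - + k)) * + 1 - + k * + k * + k * + 1) * w (suc n) k
        ≡⟨ difference k ⟩
      G (suc k) - G k ∎
    zero-sum : N * N * moment n + - (N * N) * moment (suc n) ≡ + 0
    zero-sum = begin
      N * N * moment n + - (N * N) * moment (suc n)
        -- The shorter sum is padded by its vanishing term at k = n + 1, so that both run over the
        -- same range.
        ≡⟨ cong (λ y → N * N * y + - (N * N) * moment (suc n)) (sumℤ-extend f₀ n f₀[1+n]≡0) ⟨
      N * N * sumℤ f₀ (suc n) + - (N * N) * sumℤ f₁ (suc n)
        ≡⟨ sumℤ-linear (N * N) (- (N * N)) f₀ f₁ (suc n) ⟨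
      sumℤ (λ k → N * N * f₀ k + - (N * N) * f₁ k) (suc n)
        ≡⟨ sumℤ-cong termwise (suc n) ⟩
      sumℤ (λ k → G (suc k) - G k) (suc n)
        ≡⟨ sum≡0 ⟩
      + 0 ∎
      where
      f₀[1+n]≡0 : f₀ (suc n) ≡ + 0
      f₀[1+n]≡0 = trans (cong ((+ 3 * + suc n - + 2 * + n) *_) (w-vanishes (ℕ.n<1+n n))) (ℤ.*-zeroʳ (+ 3 * + suc n - + 2 * + n))

  moment≡0 : ∀ n → moment n ≡ + 0
  moment≡0 zero    = refl
  moment≡0 (suc n) = trans (moment-suc n) (moment≡0 n)

  -- The sequence 1, 3, 15, 93, 639, ..., which counts closed walks of length 2n on the honeycomb
  -- lattice.
  g : ℕ → ℤ
  g n = sumℤ (w n) n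

  -- Termwise 3(2k+1) = 2(3k - 2n) + (4n+3), and the first part sums to the vanishing moment.
  3S≡[4n+3]g : ∀ n → + 3 * + S n ≡ (+ 4 * + n + + 3) * g n
  3S≡[4n+3]g n = begin
    + 3 * + S n                                              ≡⟨ cong (+ 3 *_) (pos-sumUpTo _ n) ⟩
    + 3 * sumℤ (λ k → + S-term k) n                           ≡⟨ cong (+ 3 *_) (sumℤ-cong S-term≡ n) ⟩
    + 3 * sumℤ (λ k → w n k * (+ 2 * + k + + 1)) n             ≡⟨ sumℤ-*ˡ (+ 3) _ n ⟨
    sumℤ (λ k → + 3 * (w n k * (+ 2 * + k + + 1))) n           ≡⟨ sumℤ-cong (λ k → ring (+ n) (+ k) (w n k)) n ⟩
    sumℤ (λ k → + 2 * ((+ 3 * + k - + 2 * + n) * w n k) + (+ 4 * + n + + 3) * w n k) n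
                                                             ≡⟨ sumℤ-linear (+ 2) (+ 4 * + n + + 3) _ (w n) n ⟩
    + 2 * moment n + (+ 4 * + n + + 3) * g n                       ≡⟨ cong (λ x → + 2 * x + (+ 4 * + n + + 3) * g n) (moment≡0 n) ⟩
    + 2 * + 0 + (+ 4 * + n + + 3) * g n                       ≡⟨ ℤ.+-identityˡ _ ⟩
    (+ 4 * + n + + 3) * g n                                  ∎
    where
    S-term : ℕ → ℕ
    S-term k = (n C k) ℕ.^ 2 ℕ.* ((2 ℕ.* k) C k) ℕ.* (2 ℕ.* k ℕ.+ 1)
    S-term≡ : ∀ k → + S-term k ≡ w n k * (+ 2 * + k + + 1)
    S-term≡ k = begin
      + ((n C k) ℕ.^ 2 ℕ.* ((2 ℕ.* k) C k) ℕ.* (2 ℕ.* k ℕ.+ 1))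
        ≡⟨ ℤ.pos-* ((n C k) ℕ.^ 2 ℕ.* ((2 ℕ.* k) C k)) (2 ℕ.* k ℕ.+ 1) ⟩
      + ((n C k) ℕ.^ 2 ℕ.* ((2 ℕ.* k) C k)) * (+ (2 ℕ.* k) + + 1)
        ≡⟨ cong₂ (λ x y → x * (y + + 1)) (ℤ.pos-* ((n C k) ℕ.^ 2) ((2 ℕ.* k) C k)) (ℤ.pos-* 2 k) ⟩
      + ((n C k) ℕ.^ 2) * central k * (+ 2 * + k + + 1)
        ≡⟨ cong (λ x → + ((n C k) ℕ.* x) * central k * (+ 2 * + k + + 1)) (ℕ.*-identityʳ (n C k)) ⟩
      + ((n C k) ℕ.* (n C k)) * central k * (+ 2 * + k + + 1)
        ≡⟨ cong (λ x → x * central k * (+ 2 * + k + + 1)) (ℤ.pos-* (n C k) (n C k)) ⟩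
      w n k * (+ 2 * + k + + 1) ∎
    ring : ∀ n k v → + 3 * (v * (+ 2 * k + + 1)) ≡ + 2 * ((+ 3 * k - + 2 * n) * v) + (+ 4 * n + + 3) * v
    ring = ℤ-Solver.solve-∀

  -- Moved to row n + 2 by `w-lift`, (n+2)^2 times the combined summand is a difference with the
  -- linear certificate 3k - 4n - 8; `ring₃` is the polynomial identity that verifies it.
  g-recurrence : ∀ n → let N = + suc (suc n); M = + suc n; p = + 10 * (+ n * + n) + + 30 * + n + + 23 in
    N * N * g (suc (suc n)) + + 9 * (M * M) * g n ≡ p * g (suc n)
  g-recurrence n = begin
    N * N * g (suc (suc n)) + + 9 * (M * M) * g n
      ≡⟨ ring₄ (N * N * g (suc (suc n)) + + 9 * (M * M) * g n) p (g (suc n)) ⟩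
    + 1 * (N * N * g (suc (suc n)) + + 9 * (M * M) * g n) + - p * g (suc n) + p * g (suc n)
      ≡⟨ cong (λ y → y + p * g (suc n)) expanded ⟨
    sumℤ term (suc (suc n)) + p * g (suc n)
      ≡⟨ cong (λ y → y + p * g (suc n)) term-sum≡0 ⟩
    + 0 + p * g (suc n)
      ≡⟨ ℤ.+-identityˡ _ ⟩
    p * g (suc n) ∎
    where
    N = + suc (suc n)
    M = + suc n
    p = + 10 * (+ n * + n) + + 30 * + n + + 23
    open Certificate (suc (suc n)) (λ k → + 3 * + k - + 4 * + n - + 8)

    ring₁ : ∀ n p a b c → let N = + 2 + n; M = + 1 + n in
      N * N * (+ 1 * (N * N * a + + 9 * (M * M) * b) + - p * c)
      ≡ N * N * (N * N) * a + + 9 * (N * N * (M * M * b)) - p * (N * N * c)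
    ring₁ = ℤ-Solver.solve-∀
    ring₂ : ∀ N e a → + 9 * (N * N * (e * e * a)) ≡ + 9 * (e * e) * (N * N * a)
    ring₂ = ℤ-Solver.solve-∀
    ring₃ : ∀ n k a → let N = + 2 + n; d = N - k; e = + 1 + n - k; p = + 10 * (n * n) + + 30 * n + + 23 in
      N * N * (N * N) * a + + 9 * (e * e) * (d * d * a) - p * (d * d * a)
      ≡ (+ 2 * (+ 2 * k + + 1) * (d * d) * (+ 3 * (+ 1 + k) - + 4 * n - + 8) - k * k * k * (+ 3 * k - + 4 * n - + 8)) * a
    ring₃ = ℤ-Solver.solve-∀

    term : ℕ → ℤ
    -- The coefficient `+ 1` gives the three-term combination the nested shape that two uses of
    -- `sumℤ-linear` take apart.
    term k = + 1 * (N * N * w (suc (suc n)) k + + 9 * (M * M) * w n k) + - p * w (suc n) k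

    termwise : ∀ k → N * N * term k ≡ G (suc k) - G k
    termwise k = begin
      N * N * term k
        ≡⟨ ring₁ (+ n) p w₂ w₀ w₁ ⟩
      N * N * (N * N) * w₂ + + 9 * (N * N * (M * M * w₀)) - p * (N * N * w₁)
        ≡⟨ cong (λ y → N * N * (N * N) * w₂ + + 9 * (N * N * y) - p * (N * N * w₁)) (w-lift n k) ⟩
      N * N * (N * N) * w₂ + + 9 * (N * N * (e * e * w₁)) - p * (N * N * w₁)
        ≡⟨ cong (λ y → N * N * (N * N) * w₂ + y - p * (N * N * w₁)) (ring₂ N e w₁) ⟩
      N * N * (N * N) * w₂ + + 9 * (e * e) * (N * N * w₁) - p * (N * N * w₁)
        ≡⟨ cong (λ y → N * N * (N * N) * w₂ + + 9 * (e * e) * y - p * y) (w-lift (suc n) k) ⟩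
      N * N * (N * N) * w₂ + + 9 * (e * e) * (d * d * w₂) - p * (d * d * w₂)
        ≡⟨ ring₃ (+ n) (+ k) w₂ ⟩
      (+ 2 * (+ 2 * + k + + 1) * (d * d) * (+ 3 * + suc k - + 4 * + n - + 8) - + k * + k * + k * (+ 3 * + k - + 4 * + n - + 8)) * w₂
        ≡⟨ difference k ⟩
      G (suc k) - G k ∎
      where
      w₀ = w n k
      w₁ = w (suc n) k
      w₂ = w (suc (suc n)) k
      d = N - + k
      e = M - + k

    term-sum≡0 : sumℤ term (suc (suc n)) ≡ + 0
    term-sum≡0 = ℤ.*-cancelˡ-≡ (N * N) _ _ (begin
      N * N * sumℤ term (suc (suc n))                ≡⟨ sumℤ-*ˡ (N * N) term (suc (suc n)) ⟨
      sumℤ (λ k → N * N * term k) (suc (suc n))      ≡⟨ sumℤ-cong termwise (suc (suc n)) ⟩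
      sumℤ (λ k → G (suc k) - G k) (suc (suc n))     ≡⟨ sum≡0 ⟩
      + 0                                            ≡⟨ ℤ.*-zeroʳ (N * N) ⟨
      N * N * + 0                                    ∎)

    ring₄ : ∀ x p y → x ≡ + 1 * x + - p * y + p * y
    ring₄ = ℤ-Solver.solve-∀
    g₀ : sumℤ (w n) (suc (suc n)) ≡ g n
    g₀ = trans (sumℤ-extend (w n) (suc n) (w-vanishes (ℕ.m≤n+m (suc n) 1))) (sumℤ-extend (w n) n (w-vanishes (ℕ.n<1+n n)))
    g₁ : sumℤ (w (suc n)) (suc (suc n)) ≡ g (suc n)
    g₁ = sumℤ-extend (w (suc n)) (suc n) (w-vanishes (ℕ.n<1+n (suc n)))
    expanded : sumℤ term (suc (suc n)) ≡ + 1 * (N * N * g (suc (suc n)) + + 9 * (M * M) * g n) + - p * g (suc n)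
    expanded = begin
      sumℤ term (suc (suc n))
        ≡⟨ sumℤ-linear (+ 1) (- p) _ (w (suc n)) (suc (suc n)) ⟩
      + 1 * sumℤ (λ k → N * N * w (suc (suc n)) k + + 9 * (M * M) * w n k) (suc (suc n)) + - p * sumℤ (w (suc n)) (suc (suc n))
        ≡⟨ cong₂ (λ y z → + 1 * y + - p * z) (sumℤ-linear (N * N) (+ 9 * (M * M)) (w (suc (suc n))) (w n) (suc (suc n))) g₁ ⟩
      + 1 * (N * N * g (suc (suc n)) + + 9 * (M * M) * sumℤ (w n) (suc (suc n))) + - p * g (suc n)
        ≡⟨ cong (λ y → + 1 * (N * N * g (suc (suc n)) + + 9 * (M * M) * y) + - p * g (suc n)) g₀ ⟩
      + 1 * (N * N * g (suc (suc n)) + + 9 * (M * M) * g n) + - p * g (suc n) ∎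

-- The recurrence for S in natural numbers

module _ where
  open import Data.Nat using (_+_; _*_)

  -- num m / den m is b(m+1).  The block is opaque because comparing unfolded copies of these
  -- polynomials expands their numerals in unary.
  opaque
    P Q q num den : ℕ → ℕ
    P n = (n * 4 + 3) * (n * 4 + 7) * ((n + 2) * (n + 2))
    Q n = (n * 4 + 7) * (n * 4 + 11) * ((n + 1) * (n + 1)) * 9
    q n = (n * 4 + 3) * (n * 4 + 11) * (n * n * 10 + n * 30 + 23)
    num m = (m * m * 4 + m * 12 + 7) * 9
    den m = (m * 2 + 3) * (m * 2 + 3)

    -- Substituting g(n) = 3 S(n)/(4n+3) into `g-recurrence` produces the denominators 4n+3, 4n+7
    -- and 4n+11. Multiplying by all three leaves two of them in each of `P`, `Q` and `q`.
    S-recurrence : ∀ n → P n * S (suc (suc n)) + Q n * S n ≡ q n * S (suc n)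
    S-recurrence n = ℤ.+-injective (ℤ.*-cancelˡ-≡ (+ 3) _ _ (begin
      + 3 ℤ.* + (P n * S (suc (suc n)) + Q n * S n)
        ≡⟨ cong₂ (λ s t → + 3 ℤ.* (s ℤ.+ t)) (pos-*₂ (P n) _ pos-P) (pos-*₂ (Q n) _ pos-Q) ⟩
      + 3 ℤ.* (P′ ℤ.* + S (suc (suc n)) ℤ.+ Q′ ℤ.* + S n)
        ≡⟨ ring₁ P′ Q′ (+ S (suc (suc n))) (+ S n) ⟩
      P′ ℤ.* (+ 3 ℤ.* + S (suc (suc n))) ℤ.+ Q′ ℤ.* (+ 3 ℤ.* + S n)
        ≡⟨ cong₂ (λ u v → P′ ℤ.* u ℤ.+ Q′ ℤ.* v) (3S≡[4n+3]g (suc (suc n))) (3S≡[4n+3]g n) ⟩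
      P′ ℤ.* ((+ 4 ℤ.* + suc (suc n) ℤ.+ + 3) ℤ.* g (suc (suc n))) ℤ.+ Q′ ℤ.* ((+ 4 ℤ.* + n ℤ.+ + 3) ℤ.* g n)
        ≡⟨ ring₂ (+ n) (g (suc (suc n))) (g n) ⟩
      a ℤ.* b ℤ.* e ℤ.* (N ℤ.* N ℤ.* g (suc (suc n)) ℤ.+ + 9 ℤ.* (M ℤ.* M) ℤ.* g n)
        ≡⟨ cong (a ℤ.* b ℤ.* e ℤ.*_) (g-recurrence n) ⟩
      a ℤ.* b ℤ.* e ℤ.* (p ℤ.* g (suc n))
        ≡⟨ ring₃ (+ n) (g (suc n)) ⟩
      q′ ℤ.* ((+ 4 ℤ.* + suc n ℤ.+ + 3) ℤ.* g (suc n))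
        ≡⟨ cong (q′ ℤ.*_) (3S≡[4n+3]g (suc n)) ⟨
      q′ ℤ.* (+ 3 ℤ.* + S (suc n))
        ≡⟨ ring₄ q′ (+ S (suc n)) ⟩
      + 3 ℤ.* (q′ ℤ.* + S (suc n))
        ≡⟨ cong (+ 3 ℤ.*_) (pos-*₂ (q n) _ pos-q) ⟨
      + 3 ℤ.* + (q n * S (suc n)) ∎))
      where
      open ≡-Reasoning
      N M p a b e P′ Q′ q′ : ℤ
      N = + suc (suc n)
      M = + suc n
      p = + 10 ℤ.* (+ n ℤ.* + n) ℤ.+ + 30 ℤ.* + n ℤ.+ + 23
      a = + n ℤ.* + 4 ℤ.+ + 3
      b = + n ℤ.* + 4 ℤ.+ + 7
      e = + n ℤ.* + 4 ℤ.+ + 11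
      P′ = a ℤ.* b ℤ.* ((+ n ℤ.+ + 2) ℤ.* (+ n ℤ.+ + 2))
      Q′ = b ℤ.* e ℤ.* ((+ n ℤ.+ + 1) ℤ.* (+ n ℤ.+ + 1)) ℤ.* + 9
      q′ = a ℤ.* e ℤ.* (+ n ℤ.* + n ℤ.* + 10 ℤ.+ + n ℤ.* + 30 ℤ.+ + 23)
      pos-*₂ : ∀ {i} u v → + u ≡ i → + (u * v) ≡ i ℤ.* + v
      pos-*₂ u v eq = trans (ℤ.pos-* u v) (cong (ℤ._* + v) eq)
      linear : ∀ k → + (n * 4 + k) ≡ + n ℤ.* + 4 ℤ.+ + k
      linear k = cong (ℤ._+ + k) (ℤ.pos-* n 4)
      linear² : ∀ k l → + ((n * 4 + k) * (n * 4 + l)) ≡ (+ n ℤ.* + 4 ℤ.+ + k) ℤ.* (+ n ℤ.* + 4 ℤ.+ + l)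
      linear² k l = trans (ℤ.pos-* (n * 4 + k) (n * 4 + l)) (cong₂ ℤ._*_ (linear k) (linear l))
      square : ∀ k → + ((n + k) * (n + k)) ≡ (+ n ℤ.+ + k) ℤ.* (+ n ℤ.+ + k)
      square k = ℤ.pos-* (n + k) (n + k)
      quadratic : + (n * n * 10 + n * 30 + 23) ≡ + n ℤ.* + n ℤ.* + 10 ℤ.+ + n ℤ.* + 30 ℤ.+ + 23
      quadratic = cong₂ (λ s t → s ℤ.+ t ℤ.+ + 23) (pos-*₂ (n * n) 10 (ℤ.pos-* n n)) (ℤ.pos-* n 30)
      pos-P : + P n ≡ P′
      pos-P = trans (ℤ.pos-* ((n * 4 + 3) * (n * 4 + 7)) _) (cong₂ ℤ._*_ (linear² 3 7) (square 2))
      pos-Q : + Q n ≡ Q′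
      pos-Q = pos-*₂ ((n * 4 + 7) * (n * 4 + 11) * ((n + 1) * (n + 1))) 9
        (trans (ℤ.pos-* ((n * 4 + 7) * (n * 4 + 11)) _) (cong₂ ℤ._*_ (linear² 7 11) (square 1)))
      pos-q : + q n ≡ q′
      pos-q = trans (ℤ.pos-* ((n * 4 + 3) * (n * 4 + 11)) _) (cong₂ ℤ._*_ (linear² 3 11) quadratic)
      ring₁ : ∀ P Q z x → + 3 ℤ.* (P ℤ.* z ℤ.+ Q ℤ.* x) ≡ P ℤ.* (+ 3 ℤ.* z) ℤ.+ Q ℤ.* (+ 3 ℤ.* x)
      ring₁ = ℤ-Solver.solve-∀
      ring₂ : ∀ n z x → let N = + 2 ℤ.+ n; M = + 1 ℤ.+ n; a = n ℤ.* + 4 ℤ.+ + 3; b = n ℤ.* + 4 ℤ.+ + 7; e = n ℤ.* + 4 ℤ.+ + 11 in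
        a ℤ.* b ℤ.* ((n ℤ.+ + 2) ℤ.* (n ℤ.+ + 2)) ℤ.* ((+ 4 ℤ.* (+ 2 ℤ.+ n) ℤ.+ + 3) ℤ.* z)
          ℤ.+ b ℤ.* e ℤ.* ((n ℤ.+ + 1) ℤ.* (n ℤ.+ + 1)) ℤ.* + 9 ℤ.* ((+ 4 ℤ.* n ℤ.+ + 3) ℤ.* x)
        ≡ a ℤ.* b ℤ.* e ℤ.* (N ℤ.* N ℤ.* z ℤ.+ + 9 ℤ.* (M ℤ.* M) ℤ.* x)
      ring₂ = ℤ-Solver.solve-∀
      ring₃ : ∀ n y → let a = n ℤ.* + 4 ℤ.+ + 3; b = n ℤ.* + 4 ℤ.+ + 7; e = n ℤ.* + 4 ℤ.+ + 11 in
        a ℤ.* b ℤ.* e ℤ.* ((+ 10 ℤ.* (n ℤ.* n) ℤ.+ + 30 ℤ.* n ℤ.+ + 23) ℤ.* y)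
        ≡ a ℤ.* e ℤ.* (n ℤ.* n ℤ.* + 10 ℤ.+ n ℤ.* + 30 ℤ.+ + 23) ℤ.* ((+ 4 ℤ.* (+ 1 ℤ.+ n) ℤ.+ + 3) ℤ.* y)
      ring₃ = ℤ-Solver.solve-∀
      ring₄ : ∀ q y → q ℤ.* (+ 3 ℤ.* y) ≡ + 3 ℤ.* (q ℤ.* y)
      ring₄ = ℤ-Solver.solve-∀

-- Coefficientwise comparison of polynomials

module _ where
  open import Data.Nat using (_+_; _*_; _^_; _≤_; _<_)
  open ℕ.≤-Reasoning

  -- Coefficient lists, constant term first: a polynomial inequality that holds coefficientwise
  -- is then decided by computation.
  eval : List ℕ → ℕ → ℕ
  eval []      n = 0
  eval (a ∷ p) n = n * eval p n + a

  infixl 6 _⊞_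
  infixl 7 _⊠_

  _⊞_ : List ℕ → List ℕ → List ℕ
  []      ⊞ q       = q
  (a ∷ p) ⊞ []      = a ∷ p
  (a ∷ p) ⊞ (b ∷ q) = (a + b) ∷ (p ⊞ q)

  _⊠_ : List ℕ → List ℕ → List ℕ
  []      ⊠ q = []
  (a ∷ p) ⊠ q = map (a *_) q ⊞ (0 ∷ (p ⊠ q))

  -- Horner's rule at n + 1, with `1 ∷ 1 ∷ []` standing for 1 + n.
  shift : List ℕ → List ℕ
  shift []      = []
  shift (a ∷ p) = (a ∷ []) ⊞ ((1 ∷ 1 ∷ []) ⊠ shift p)

  eval-⊞ : ∀ p q n → eval (p ⊞ q) n ≡ eval p n + eval q n
  eval-⊞ []      q       n = refl
  eval-⊞ (a ∷ p) []      n = sym (ℕ.+-identityʳ _)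
  eval-⊞ (a ∷ p) (b ∷ q) n = trans (cong (λ t → n * t + (a + b)) (eval-⊞ p q n)) (ring a b n (eval p n) (eval q n))
    where
    ring : ∀ a b n s t → n * (s + t) + (a + b) ≡ n * s + a + (n * t + b)
    ring = ℕ-Solver.solve-∀

  eval-map : ∀ a p n → eval (map (a *_) p) n ≡ a * eval p n
  eval-map a []      n = sym (ℕ.*-zeroʳ a)
  eval-map a (b ∷ p) n = trans (cong (λ t → n * t + a * b) (eval-map a p n)) (ring a b n (eval p n))
    where
    ring : ∀ a b n t → n * (a * t) + a * b ≡ a * (n * t + b)
    ring = ℕ-Solver.solve-∀

  eval-⊠ : ∀ p q n → eval (p ⊠ q) n ≡ eval p n * eval q n
  eval-⊠ []      q n = refl
  eval-⊠ (a ∷ p) q n = begin-equality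
    eval (map (a *_) q ⊞ (0 ∷ (p ⊠ q))) n              ≡⟨ eval-⊞ (map (a *_) q) (0 ∷ (p ⊠ q)) n ⟩
    eval (map (a *_) q) n + (n * eval (p ⊠ q) n + 0)   ≡⟨ cong₂ (λ s t → s + (n * t + 0)) (eval-map a q n) (eval-⊠ p q n) ⟩
    a * eval q n + (n * (eval p n * eval q n) + 0)     ≡⟨ ring a n (eval p n) (eval q n) ⟩
    (n * eval p n + a) * eval q n                      ∎
    where
    ring : ∀ a n s t → a * t + (n * (s * t) + 0) ≡ (n * s + a) * t
    ring = ℕ-Solver.solve-∀

  eval-shift : ∀ p n → eval (shift p) n ≡ eval p (suc n)
  eval-shift []      n = refl
  eval-shift (a ∷ p) n = begin-equality
    eval ((a ∷ []) ⊞ ((1 ∷ 1 ∷ []) ⊠ shift p)) n               ≡⟨ eval-⊞ (a ∷ []) ((1 ∷ 1 ∷ []) ⊠ shift p) n ⟩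
    eval (a ∷ []) n + eval ((1 ∷ 1 ∷ []) ⊠ shift p) n          ≡⟨ cong (λ t → eval (a ∷ []) n + t) (eval-⊠ (1 ∷ 1 ∷ []) (shift p) n) ⟩
    eval (a ∷ []) n + eval (1 ∷ 1 ∷ []) n * eval (shift p) n   ≡⟨ cong (λ t → eval (a ∷ []) n + eval (1 ∷ 1 ∷ []) n * t) (eval-shift p n) ⟩
    eval (a ∷ []) n + eval (1 ∷ 1 ∷ []) n * eval p (suc n)     ≡⟨ ring a n (eval p (suc n)) ⟩
    suc n * eval p (suc n) + a                                 ∎
    where
    ring : ∀ a n t → (n * 0 + a) + (n * (n * 0 + 1) + 1) * t ≡ (1 + n) * t + a
    ring = ℕ-Solver.solve-∀

  -- On closed lists that satisfy it this computes to nested products of unit types, so the proof is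
  -- supplied by eta as `_`.
  _≼_ : List ℕ → List ℕ → Set
  []      ≼ q       = ⊤
  (a ∷ p) ≼ []      = ⊥
  (a ∷ p) ≼ (b ∷ q) = T (a ℕ.≤ᵇ b) × p ≼ q

  eval-mono : ∀ p q → p ≼ q → ∀ n → eval p n ≤ eval q n
  eval-mono []      q       _           n = ℕ.z≤n
  eval-mono (a ∷ p) (b ∷ q) (a≤b , p≼q) n = ℕ.+-mono-≤ (ℕ.*-monoʳ-≤ n (eval-mono p q p≼q n)) (ℕ.≤ᵇ⇒≤ a b a≤b)

  -- A record rather than the bare equation, so that composing the combinators below determines both
  -- the function and its coefficients by unification.
  record Represents (f : ℕ → ℕ) (p : List ℕ) : Set where
    constructor represents
    field pointwise : ∀ n → f n ≡ eval p n
  open Represents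

  infixl 6 _+ᴿ_
  infixl 7 _*ᴿ_

  _+ᴿ_ : ∀ {f g p q} → Represents f p → Represents g q → Represents (λ n → f n + g n) (p ⊞ q)
  _+ᴿ_ {p = p} {q} f g .pointwise n = trans (cong₂ _+_ (f .pointwise n) (g .pointwise n)) (sym (eval-⊞ p q n))

  _*ᴿ_ : ∀ {f g p q} → Represents f p → Represents g q → Represents (λ n → f n * g n) (p ⊠ q)
  _*ᴿ_ {p = p} {q} f g .pointwise n = trans (cong₂ _*_ (f .pointwise n) (g .pointwise n)) (sym (eval-⊠ p q n))

  shiftᴿ : ∀ {f p} → Represents f p → Represents (λ n → f (suc n)) (shift p)
  shiftᴿ {p = p} f .pointwise n = trans (f .pointwise (suc n)) (sym (eval-shift p n))

  conᴿ : ∀ a → Represents (λ _ → a) (a ∷ [])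
  conᴿ a .pointwise n = cong (_+ a) (sym (ℕ.*-zeroʳ n))

  varᴿ : Represents (λ n → n) (0 ∷ 1 ∷ [])
  varᴿ .pointwise = ring
    where
    ring : ∀ n → n ≡ n * (n * 0 + 1) + 0
    ring = ℕ-Solver.solve-∀

  ≤ᴿ : ∀ {f g p q} → Represents f p → Represents g q → p ≼ q → ∀ n → f n ≤ g n
  ≤ᴿ {f} {g} {p} {q} f≗p g≗q p≼q n = begin
    f n        ≡⟨ f≗p .pointwise n ⟩
    eval p n   ≤⟨ eval-mono p q p≼q n ⟩
    eval q n   ≡⟨ g≗q .pointwise n ⟨
    g n        ∎

  linearᴿ : ∀ a b → Represents (λ n → n * b + a) (a ∷ b ∷ [])
  linearᴿ a b .pointwise n = ring a b n
    where
    ring : ∀ a b n → n * b + a ≡ n * (n * 0 + b) + a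
    ring = ℕ-Solver.solve-∀

  monicᴿ : ∀ a → Represents (λ n → n + a) (a ∷ 1 ∷ [])
  monicᴿ a .pointwise n = ring a n
    where
    ring : ∀ a n → n + a ≡ n * (n * 0 + 1) + a
    ring = ℕ-Solver.solve-∀

  opaque
    unfolding P

    -- These expanded coefficients are all that the two polynomial inequalities see of the opaque
    -- functions.
    Pᴿ : Represents P (84 ∷ 244 ∷ 245 ∷ 104 ∷ 16 ∷ [])
    Pᴿ = let r = linearᴿ 3 4 *ᴿ linearᴿ 7 4 *ᴿ (monicᴿ 2 *ᴿ monicᴿ 2) in represents (r .pointwise)

    Qᴿ : Represents Q (693 ∷ 2034 ∷ 2133 ∷ 936 ∷ 144 ∷ [])
    Qᴿ = let r = linearᴿ 7 4 *ᴿ linearᴿ 11 4 *ᴿ (monicᴿ 1 *ᴿ monicᴿ 1) *ᴿ conᴿ 9 in represents (r .pointwise)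

    qᴿ : Represents q (759 ∷ 2278 ∷ 2378 ∷ 1040 ∷ 160 ∷ [])
    qᴿ = let r = linearᴿ 3 4 *ᴿ linearᴿ 11 4 *ᴿ (varᴿ *ᴿ varᴿ *ᴿ conᴿ 10 +ᴿ varᴿ *ᴿ conᴿ 30 +ᴿ conᴿ 23) in represents (r .pointwise)

    numᴿ : Represents num (63 ∷ 108 ∷ 36 ∷ [])
    numᴿ = let r = (varᴿ *ᴿ varᴿ *ᴿ conᴿ 4 +ᴿ varᴿ *ᴿ conᴿ 12 +ᴿ conᴿ 7) *ᴿ conᴿ 9 in represents (r .pointwise)

    denᴿ : Represents den (9 ∷ 12 ∷ 4 ∷ [])
    denᴿ = let r = linearᴿ 3 2 *ᴿ linearᴿ 3 2 in represents (r .pointwise)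

  -- Interlacing bounds for consecutive ratios

  lower-bound-polynomial : ∀ m →
    num (suc m) * num m * P (suc m) + den (suc m) * den m * Q (suc m) ≤ den (suc m) * num m * q (suc m)
  lower-bound-polynomial =
    let l = shiftᴿ numᴿ *ᴿ numᴿ *ᴿ shiftᴿ Pᴿ +ᴿ shiftᴿ denᴿ *ᴿ denᴿ *ᴿ shiftᴿ Qᴿ
        r = shiftᴿ denᴿ *ᴿ numᴿ *ᴿ shiftᴿ qᴿ
    in ≤ᴿ l r _

  upper-bound-polynomial : ∀ n →
    den (suc n) * num n * q n ≤ num (suc n) * num n * P n + den (suc n) * den n * Q n
  upper-bound-polynomial =
    let l = shiftᴿ denᴿ *ᴿ numᴿ *ᴿ qᴿ
        r = shiftᴿ numᴿ *ᴿ numᴿ *ᴿ Pᴿ +ᴿ shiftᴿ denᴿ *ᴿ denᴿ *ᴿ Qᴿ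
    in ≤ᴿ l r _

  -- The recurrence reads z/y = q/P - (Q/P)(x/y), which increases with y/x. A bound b/a on y/x
  -- therefore passes to a bound b′/a′ on z/y as soon as q/P - (Q/P)(a/b) lies on the right side of
  -- b′/a′; this is the polynomial hypothesis without fractions. Instead of subtracting, the Q-terms
  -- are added to both sides and cancelled.
  module _ {P Q q x y z a b a′ b′ : ℕ} (recurrence : P * z + Q * x ≡ q * y) where
    private
      expand : a′ * b * P * z + a′ * Q * (b * x) ≡ a′ * b * q * y
      expand = begin-equality
        a′ * b * P * z + a′ * Q * (b * x)  ≡⟨ ring a′ b P z Q x ⟩
        a′ * b * (P * z + Q * x)           ≡⟨ cong (a′ * b *_) recurrence ⟩
        a′ * b * (q * y)                   ≡⟨ ℕ.*-assoc (a′ * b) q y ⟨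
        a′ * b * q * y                     ∎
        where
        ring : ∀ a b P z Q x → a * b * P * z + a * Q * (b * x) ≡ a * b * (P * z + Q * x)
        ring = ℕ-Solver.solve-∀

      split : (b′ * b * P + a′ * a * Q) * y ≡ b * P * (b′ * y) + a′ * Q * (a * y)
      split = ring a b a′ b′ P Q y
        where
        ring : ∀ a b a′ b′ P Q y → (b′ * b * P + a′ * a * Q) * y ≡ b * P * (b′ * y) + a′ * Q * (a * y)
        ring = ℕ-Solver.solve-∀

      regroup : b * P * (a′ * z) ≡ a′ * b * P * z
      regroup = ring b P a′ z
        where
        ring : ∀ b P a z → b * P * (a * z) ≡ a * b * P * z
        ring = ℕ-Solver.solve-∀

    lower-bound-step : .{{_ : ℕ.NonZero (b * P)}} →
      b′ * b * P + a′ * a * Q ≤ a′ * b * q → b * x ≤ a * y → b′ * y ≤ a′ * z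
    lower-bound-step poly bx≤ay = ℕ.*-cancelˡ-≤ (b * P) (ℕ.+-cancelʳ-≤ (a′ * Q * (a * y)) _ _ (begin
      b * P * (b′ * y) + a′ * Q * (a * y)  ≡⟨ split ⟨
      (b′ * b * P + a′ * a * Q) * y        ≤⟨ ℕ.*-monoˡ-≤ y poly ⟩
      a′ * b * q * y                       ≡⟨ expand ⟨
      a′ * b * P * z + a′ * Q * (b * x)    ≤⟨ ℕ.+-monoʳ-≤ (a′ * b * P * z) (ℕ.*-monoʳ-≤ (a′ * Q) bx≤ay) ⟩
      a′ * b * P * z + a′ * Q * (a * y)    ≡⟨ cong (_+ a′ * Q * (a * y)) regroup ⟨
      b * P * (a′ * z) + a′ * Q * (a * y)  ∎))

    upper-bound-step : .{{_ : ℕ.NonZero (a′ * Q)}} →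
      a′ * b * q ≤ b′ * b * P + a′ * a * Q → a * y < b * x → a′ * z < b′ * y
    upper-bound-step poly ay<bx = ℕ.*-cancelˡ-< (b * P) _ _ (ℕ.+-cancelʳ-< (a′ * Q * (b * x)) _ _ (begin-strict
      b * P * (a′ * z) + a′ * Q * (b * x)  ≡⟨ cong (_+ a′ * Q * (b * x)) regroup ⟩
      a′ * b * P * z + a′ * Q * (b * x)    ≡⟨ expand ⟩
      a′ * b * q * y                       ≤⟨ ℕ.*-monoˡ-≤ y poly ⟩
      (b′ * b * P + a′ * a * Q) * y        ≡⟨ split ⟩
      b * P * (b′ * y) + a′ * Q * (a * y)  <⟨ ℕ.+-monoʳ-< (b * P * (b′ * y)) (ℕ.*-monoʳ-< (a′ * Q) ay<bx) ⟩
      b * P * (b′ * y) + a′ * Q * (b * x)  ∎))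

  opaque
    unfolding P

    den-nonZero : ∀ m → ℕ.NonZero (den m)
    den-nonZero m rewrite ℕ.+-comm (m * 2) 3 = _

    num*P-nonZero : ∀ m n → ℕ.NonZero (num m * P n)
    num*P-nonZero m n rewrite ℕ.+-comm (m * m * 4 + m * 12) 7 | ℕ.+-comm (n * 4) 3 | ℕ.+-comm (n * 4) 7 | ℕ.+-comm n 2 = _

    Q-nonZero : ∀ n → ℕ.NonZero (Q n)
    Q-nonZero n rewrite ℕ.+-comm (n * 4) 7 | ℕ.+-comm (n * 4) 11 | ℕ.+-comm n 1 = _

    -- Both inductions start at S(2)/S(1) = 55/7, between b(1) = 7 and b(2) = 207/25. One index
    -- lower the strict upper bound fails, as S(1)/S(0) = 7 = b(1).
    ratio-lower-bound₀ : num 0 * S 1 ≤ den 0 * S 2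
    ratio-lower-bound₀ = toWitness {a? = num 0 * S 1 ℕ.≤? den 0 * S 2} _

    ratio-upper-bound₁ : den 1 * S 2 < num 1 * S 1
    ratio-upper-bound₁ = toWitness {a? = den 1 * S 2 ℕ.<? num 1 * S 1} _

    num+18≡9den : ∀ m → num m + 18 ≡ 9 * den m
    num+18≡9den = ring
      where
      ring : ∀ m → (m * m * 4 + m * 12 + 7) * 9 + 18 ≡ 9 * ((m * 2 + 3) * (m * 2 + 3))
      ring = ℕ-Solver.solve-∀

    m<den : ∀ m → m < den m
    m<den m = ℕ.≤-trans (ℕ.m≤m+n (suc m) _) (ℕ.≤-reflexive (sym (ring m)))
      where
      ring : ∀ m → (m * 2 + 3) * (m * 2 + 3) ≡ suc m + (m * m * 4 + m * 11 + 8)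
      ring = ℕ-Solver.solve-∀

    den<num : ∀ m → den m < num m
    den<num m = ℕ.≤-trans (ℕ.m≤m+n (suc (den m)) _) (ℕ.≤-reflexive (sym (ring m)))
      where
      ring : ∀ m → (m * m * 4 + m * 12 + 7) * 9 ≡ suc ((m * 2 + 3) * (m * 2 + 3)) + (m * m * 32 + m * 96 + 53)
      ring = ℕ-Solver.solve-∀

    -- Together with `num≡9*` this gives the bound the form 9d/(2+d) used with Bernoulli's
    -- inequality.
    den≡2+ : ∀ m → den m ≡ 2 + (m * m * 4 + m * 12 + 7)
    den≡2+ = ring
      where
      ring : ∀ m → (m * 2 + 3) * (m * 2 + 3) ≡ 2 + (m * m * 4 + m * 12 + 7)
      ring = ℕ-Solver.solve-∀

    num≡9* : ∀ m → num m ≡ 9 * (m * m * 4 + m * 12 + 7)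
    num≡9* m = ℕ.*-comm (m * m * 4 + m * 12 + 7) 9

  ratio-lower-bound : ∀ m → num m * S (suc m) ≤ den m * S (suc (suc m))
  ratio-lower-bound zero    = ratio-lower-bound₀
  ratio-lower-bound (suc m) =
    lower-bound-step {P = P (suc m)} {Q (suc m)} {q (suc m)} {S (suc m)} {S (suc (suc m))} {S (suc (suc (suc m)))}
      {den m} {num m} {den (suc m)} {num (suc m)}
      (S-recurrence (suc m)) {{num*P-nonZero m (suc m)}} (lower-bound-polynomial m) (ratio-lower-bound m)

  ratio-upper-bound : ∀ m → den (suc m) * S (suc (suc m)) < num (suc m) * S (suc m)
  ratio-upper-bound zero    = ratio-upper-bound₁
  ratio-upper-bound (suc m) =
    upper-bound-step {P = P (suc m)} {Q (suc m)} {q (suc m)} {S (suc m)} {S (suc (suc m))} {S (suc (suc (suc m)))}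
      {den (suc m)} {num (suc m)} {den (suc (suc m))} {num (suc (suc m))}
      (S-recurrence (suc m)) {{nonZero}} (upper-bound-polynomial (suc m)) (ratio-upper-bound m)
    where
    nonZero : ℕ.NonZero (den (suc (suc m)) * Q (suc m))
    nonZero = ℕ.m*n≢0 (den (suc (suc m))) (Q (suc m)) {{den-nonZero (suc (suc m))}} {{Q-nonZero (suc m)}}

  S-log-convex : ∀ m → S (suc (suc m)) * S (suc (suc m)) < S (suc m) * S (suc (suc (suc m)))
  S-log-convex m = ℕ.*-cancelˡ-< (num (suc m)) _ _ (begin-strict
    num (suc m) * (y * y)    ≡⟨ ℕ.*-assoc (num (suc m)) y y ⟨
    num (suc m) * y * y      ≤⟨ ℕ.*-monoˡ-≤ y (ratio-lower-bound (suc m)) ⟩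
    den (suc m) * z * y      ≡⟨ swap (den (suc m)) z y ⟩
    den (suc m) * y * z      <⟨ ℕ.*-monoˡ-< z {{S-nonZero (suc (suc (suc m)))}} (ratio-upper-bound m) ⟩
    num (suc m) * x * z      ≡⟨ ℕ.*-assoc (num (suc m)) x z ⟩
    num (suc m) * (x * z)    ∎)
    where
    x = S (suc m)
    y = S (suc (suc m))
    z = S (suc (suc (suc m)))
    swap : ∀ a b c → a * b * c ≡ a * c * b
    swap = ℕ-Solver.solve-∀

  -- The lower bound in the form 9 - 18/den, from which the limit is read off.
  9S-bound : ∀ m → 9 * den m * S (suc m) ≤ den m * S (suc (suc m)) + 18 * S (suc m)
  9S-bound m = begin
    9 * den m * x                       ≡⟨ cong (_* x) (num+18≡9den m) ⟨
    (num m + 18) * x                    ≡⟨ ℕ.*-distribʳ-+ x (num m) 18 ⟩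
    num m * x + 18 * x                  ≤⟨ ℕ.+-monoˡ-≤ (18 * x) (ratio-lower-bound m) ⟩
    den m * S (suc (suc m)) + 18 * x    ∎
    where x = S (suc m)

  S-suc<9S : ∀ n .{{_ : ℕ.NonZero n}} → S (suc n) < 9 * S n
  S-suc<9S n@(suc m) = ℕ.*-cancelˡ-< (den n) _ _ (begin-strict
    den n * S (suc n)      <⟨ ratio-upper-bound m ⟩
    num n * S n            ≤⟨ ℕ.*-monoˡ-≤ (S n) (ℕ.m≤m+n (num n) 18) ⟩
    (num n + 18) * S n     ≡⟨ cong (_* S n) (num+18≡9den n) ⟩
    9 * den n * S n        ≡⟨ ring (den n) (S n) ⟩
    den n * (9 * S n)      ∎)
    where
    ring : ∀ d x → 9 * d * x ≡ d * (9 * x)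
    ring = ℕ-Solver.solve-∀

  S-increasing : ∀ n .{{_ : ℕ.NonZero n}} → S n < S (suc n)
  S-increasing n@(suc m) = ℕ.*-cancelˡ-< (den m) _ _ (begin-strict
    den m * S n         <⟨ ℕ.*-monoˡ-< (S n) {{S-nonZero n}} (den<num m) ⟩
    num m * S n         ≤⟨ ratio-lower-bound m ⟩
    den m * S (suc n)   ∎)

  -- The offset is added on the right so that S and _^_ do not unfold it.
  5S≤3*9^[k+6] : ∀ k → 5 * S (k + 6) ≤ 3 * 9 ^ (k + 6)
  5S≤3*9^[k+6] zero    = toWitness {a? = 5 * S 6 ℕ.≤? 3 * 9 ^ 6} _
  5S≤3*9^[k+6] (suc k) = begin
    5 * S (suc (k + 6))     ≤⟨ ℕ.*-monoʳ-≤ 5 (ℕ.<⇒≤ (S-suc<9S (k + 6) {{nonZero}})) ⟩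
    5 * (9 * S (k + 6))     ≡⟨ ring (S (k + 6)) ⟩
    9 * (5 * S (k + 6))     ≤⟨ ℕ.*-monoʳ-≤ 9 (5S≤3*9^[k+6] k) ⟩
    9 * (3 * 9 ^ (k + 6))   ≡⟨ ring′ (9 ^ (k + 6)) ⟩
    3 * 9 ^ suc (k + 6)     ∎
    where
    nonZero : ℕ.NonZero (k + 6)
    nonZero = ℕ.>-nonZero (ℕ.≤-trans (ℕ.s≤s ℕ.z≤n) (ℕ.m≤n+m 6 k))
    ring : ∀ x → 5 * (9 * x) ≡ 9 * (5 * x)
    ring = ℕ-Solver.solve-∀
    ring′ : ∀ t → 9 * (3 * t) ≡ 3 * (9 * t)
    ring′ = ℕ-Solver.solve-∀

  5S≤3*9^n : ∀ {n} → n ≥ 6 → 5 * S n ≤ 3 * 9 ^ n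
  5S≤3*9^n {n} n≥6 = subst (λ i → 5 * S i ≤ 3 * 9 ^ i) (ℕ.m∸n+n≡m n≥6) (5S≤3*9^[k+6] (n ℕ.∸ 6))

  S≤9^n : ∀ {n} → n ≥ 6 → S n ≤ 9 ^ n
  S≤9^n {n} n≥6 = ℕ.*-cancelˡ-≤ 3 (begin
    3 * S n    ≤⟨ ℕ.*-monoˡ-≤ (S n) (ℕ.m≤m+n 3 2) ⟩
    5 * S n    ≤⟨ 5S≤3*9^n n≥6 ⟩
    3 * 9 ^ n  ∎)

  -- Bernoulli's inequality and the decrease of the roots

  ^-distribʳ-* : ∀ m n k → (m * n) ^ k ≡ m ^ k * n ^ k
  ^-distribʳ-* m n zero    = refl
  ^-distribʳ-* m n (suc k) = trans (cong (m * n *_) (^-distribʳ-* m n k)) (ring m n (m ^ k) (n ^ k))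
    where
    ring : ∀ m n s t → m * n * (s * t) ≡ m * s * (n * t)
    ring = ℕ-Solver.solve-∀

  -- (1 − 2/c)^N ≥ 1 − 2N/c for c = 2 + d, cleared of denominators and subtraction.
  bernoulli-below : ∀ d N → (2 + d) * (2 + d) ^ N ≤ (2 + d) * d ^ N + 2 * N * (2 + d) ^ N
  bernoulli-below d zero    = ℕ.m≤m+n _ _
  bernoulli-below d (suc N) = begin
    c * (c * c ^ N)                          ≤⟨ ℕ.*-monoʳ-≤ c (bernoulli-below d N) ⟩
    c * (c * d ^ N + 2 * N * c ^ N)          ≡⟨ ring₁ d (d ^ N) N (c ^ N) ⟩
    c * (d * d ^ N) + 2 * N * (c * c ^ N) + 2 * (c * d ^ N)
      ≤⟨ ℕ.+-monoʳ-≤ (c * (d * d ^ N) + 2 * N * (c * c ^ N)) (ℕ.*-monoʳ-≤ 2 (ℕ.*-monoʳ-≤ c (ℕ.^-monoˡ-≤ N (ℕ.m≤n+m d 2)))) ⟩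
    c * (d * d ^ N) + 2 * N * (c * c ^ N) + 2 * (c * c ^ N)
      ≡⟨ ring₂ (c * (d * d ^ N)) N (c * c ^ N) ⟩
    c * (d * d ^ N) + 2 * suc N * (c * c ^ N) ∎
    where
    c = 2 + d
    ring₁ : ∀ d p N r → let c = 2 + d in c * (c * p + 2 * N * r) ≡ c * (d * p) + 2 * N * (c * r) + 2 * (c * p)
    ring₁ = ℕ-Solver.solve-∀
    ring₂ : ∀ a N t → a + 2 * N * t + 2 * t ≡ a + 2 * (1 + N) * t
    ring₂ = ℕ-Solver.solve-∀

  -- With c = 2 + d the hypothesis says 2N/c < 16/25, so Bernoulli's lower bound 1 - 2N/c for
  -- (d/c)^N exceeds 9/25.
  power-gap : ∀ d N → 50 * N < 16 * (2 + d) → 9 * (2 + d) ^ N < 25 * d ^ N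
  power-gap d N gap = ℕ.*-cancelˡ-< c _ _ (ℕ.+-cancelʳ-< (50 * N * r) _ _ (begin-strict
    c * (9 * r) + 50 * N * r            <⟨ ℕ.+-monoʳ-< (c * (9 * r)) (ℕ.*-monoˡ-< r {{ℕ.m^n≢0 c N}} gap) ⟩
    c * (9 * r) + 16 * c * r            ≡⟨ ring₁ c r ⟩
    25 * (c * r)                        ≤⟨ ℕ.*-monoʳ-≤ 25 (bernoulli-below d N) ⟩
    25 * (c * d ^ N + 2 * N * r)        ≡⟨ ring₂ c (d ^ N) N r ⟩
    c * (25 * d ^ N) + 50 * N * r       ∎))
    where
    c = 2 + d
    r = c ^ N
    ring₁ : ∀ c r → c * (9 * r) + 16 * c * r ≡ 25 * (c * r)
    ring₁ = ℕ-Solver.solve-∀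
    ring₂ : ∀ c p N r → 25 * (c * p + 2 * N * r) ≡ c * (25 * p) + 50 * N * r
    ring₂ = ℕ-Solver.solve-∀

  -- In use, x, y, z are three consecutive values of `S` and 9d/(2+d) is b(n). The exponents satisfy
  -- (n+1)(n+2) = N + 2 and 2n(n+2) = K + N, so replacing z by 9y and cancelling y^K leaves 9^K
  -- x^(N+2) < y^N.
  module _ {n d x y z : ℕ} .{{_ : ℕ.NonZero x}} .{{_ : ℕ.NonZero y}}
    (5x≤3*9^n : 5 * x ≤ 3 * 9 ^ n) (gap : 50 * (n * (3 + n)) < 16 * (2 + d))
    (9dx≤cy : 9 * d * x ≤ (2 + d) * y) (z≤9y : z ≤ 9 * y) where
    private
      K = n * suc n
      N = n * (3 + n)
      c = 2 + d

      25x²≤9*81^n : 25 * (x * x) ≤ 9 * (9 ^ n * 9 ^ n)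
      25x²≤9*81^n = begin
        25 * (x * x)                    ≡⟨ ring₁ x ⟩
        5 * x * (5 * x)                 ≤⟨ ℕ.*-mono-≤ 5x≤3*9^n 5x≤3*9^n ⟩
        3 * 9 ^ n * (3 * 9 ^ n)         ≡⟨ ring₂ (9 ^ n) ⟩
        9 * (9 ^ n * 9 ^ n)             ∎
        where
        ring₁ : ∀ x → 25 * (x * x) ≡ 5 * x * (5 * x)
        ring₁ = ℕ-Solver.solve-∀
        ring₂ : ∀ t → 3 * t * (3 * t) ≡ 9 * (t * t)
        ring₂ = ℕ-Solver.solve-∀

      9^N : 9 ^ n * 9 ^ n * 9 ^ K ≡ 9 ^ N
      9^N = begin-equality
        9 ^ n * 9 ^ n * 9 ^ K   ≡⟨ cong (_* 9 ^ K) (ℕ.^-distribˡ-+-* 9 n n) ⟨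
        9 ^ (n + n) * 9 ^ K     ≡⟨ ℕ.^-distribˡ-+-* 9 (n + n) K ⟨
        9 ^ (n + n + K)         ≡⟨ cong (9 ^_) (ring n) ⟩
        9 ^ N                   ∎
        where
        ring : ∀ n → n + n + n * (1 + n) ≡ n * (3 + n)
        ring = ℕ-Solver.solve-∀

      -- The bound x ≤ (3/5) 9^n trades x^2 for (9/25) 81^n, which completes 9^K to 9^N. After y/x ≥
      -- 9d/c is raised to the power N, only (d/c)^N > 9/25 remains.
      9^K*x^[N+2]<y^N : 9 ^ K * (x * x * x ^ N) < y ^ N
      9^K*x^[N+2]<y^N = ℕ.*-cancelˡ-< (25 * c ^ N) _ _ (begin-strict
        25 * c ^ N * (9 ^ K * (x * x * x ^ N))         ≡⟨ ring₁ (c ^ N) (9 ^ K) x (x ^ N) ⟩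
        25 * (x * x) * (c ^ N * (9 ^ K * x ^ N))       ≤⟨ ℕ.*-monoˡ-≤ (c ^ N * (9 ^ K * x ^ N)) 25x²≤9*81^n ⟩
        9 * (9 ^ n * 9 ^ n) * (c ^ N * (9 ^ K * x ^ N)) ≡⟨ ring₂ (9 ^ n * 9 ^ n) (c ^ N) (9 ^ K) (x ^ N) ⟩
        9 * c ^ N * (9 ^ n * 9 ^ n * 9 ^ K * x ^ N)    ≡⟨ cong (λ t → 9 * c ^ N * (t * x ^ N)) 9^N ⟩
        9 * c ^ N * (9 ^ N * x ^ N)                    <⟨ ℕ.*-monoˡ-< (9 ^ N * x ^ N) {{nonZero}} (power-gap d N gap) ⟩
        25 * d ^ N * (9 ^ N * x ^ N)                   ≡⟨ ring₃ (d ^ N) (9 ^ N) (x ^ N) ⟩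
        25 * (9 ^ N * d ^ N * x ^ N)                   ≡⟨ cong (λ t → 25 * (t * x ^ N)) (^-distribʳ-* 9 d N) ⟨
        25 * ((9 * d) ^ N * x ^ N)                     ≡⟨ cong (25 *_) (^-distribʳ-* (9 * d) x N) ⟨
        25 * (9 * d * x) ^ N                           ≤⟨ ℕ.*-monoʳ-≤ 25 (ℕ.^-monoˡ-≤ N 9dx≤cy) ⟩
        25 * (c * y) ^ N                               ≡⟨ cong (25 *_) (^-distribʳ-* c y N) ⟩
        25 * (c ^ N * y ^ N)                           ≡⟨ ℕ.*-assoc 25 (c ^ N) (y ^ N) ⟨
        25 * c ^ N * y ^ N                             ∎)
        where
        nonZero : ℕ.NonZero (9 ^ N * x ^ N)
        nonZero = ℕ.m*n≢0 (9 ^ N) (x ^ N) {{ℕ.m^n≢0 9 N}} {{ℕ.m^n≢0 x N}}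
        ring₁ : ∀ c t x p → 25 * c * (t * (x * x * p)) ≡ 25 * (x * x) * (c * (t * p))
        ring₁ = ℕ-Solver.solve-∀
        ring₂ : ∀ e c t p → 9 * e * (c * (t * p)) ≡ 9 * c * (e * t * p)
        ring₂ = ℕ-Solver.solve-∀
        ring₃ : ∀ d t p → 25 * d * (t * p) ≡ 25 * (t * d * p)
        ring₃ = ℕ-Solver.solve-∀

    powers-decrease : z ^ (n * suc n) * x ^ (suc n * suc (suc n)) < y ^ (2 * n * suc (suc n))
    powers-decrease = begin-strict
      z ^ K * x ^ (suc n * suc (suc n))         ≡⟨ cong (λ e → z ^ K * x ^ e) (ring₁ n) ⟩
      z ^ K * (x * (x * x ^ N))                 ≤⟨ ℕ.*-monoˡ-≤ (x * (x * x ^ N)) (ℕ.^-monoˡ-≤ K z≤9y) ⟩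
      (9 * y) ^ K * (x * (x * x ^ N))           ≡⟨ cong (_* (x * (x * x ^ N))) (^-distribʳ-* 9 y K) ⟩
      9 ^ K * y ^ K * (x * (x * x ^ N))         ≡⟨ ring₂ (9 ^ K) (y ^ K) x (x ^ N) ⟩
      y ^ K * (9 ^ K * (x * x * x ^ N))         <⟨ ℕ.*-monoʳ-< (y ^ K) {{ℕ.m^n≢0 y K}} 9^K*x^[N+2]<y^N ⟩
      y ^ K * y ^ N                             ≡⟨ ℕ.^-distribˡ-+-* y K N ⟨
      y ^ (K + N)                               ≡⟨ cong (y ^_) (ring₃ n) ⟩
      y ^ (2 * n * suc (suc n))                 ∎
      where
      ring₁ : ∀ n → (1 + n) * (2 + n) ≡ 2 + n * (3 + n)
      ring₁ = ℕ-Solver.solve-∀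
      ring₂ : ∀ t y x p → t * y * (x * (x * p)) ≡ y * (t * (x * x * p))
      ring₂ = ℕ-Solver.solve-∀
      ring₃ : ∀ n → n * (1 + n) + n * (3 + n) ≡ 2 * n * (2 + n)
      ring₃ = ℕ-Solver.solve-∀

  root-decreasing-≥6 : ∀ n → n ≥ 6 → rootRatioDecreasingAt n
  root-decreasing-≥6 n@(suc m) n≥6 = powers-decrease {n} {d} {S n} {S (suc n)} {S (suc (suc n))}
    {{S-nonZero n}} {{S-nonZero (suc n)}} (5S≤3*9^n n≥6) gap 9dx≤cy (ℕ.<⇒≤ (S-suc<9S (suc n)))
    where
    d = m * m * 4 + m * 12 + 7
    9dx≤cy : 9 * d * S n ≤ (2 + d) * S (suc n)
    9dx≤cy = subst₂ (λ s t → s * S n ≤ t * S (suc n)) (num≡9* m) (den≡2+ m) (ratio-lower-bound m)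
    gap : 50 * (n * (3 + n)) < 16 * (2 + d)
    -- With n = j + 6 the right side exceeds the left by 14 j^2 + 82 j + 4.
    gap = subst (λ i → 50 * (suc i * (3 + suc i)) < 16 * (2 + (i * i * 4 + i * 12 + 7)))
      (ℕ.m∸n+n≡m (ℕ.≤-pred n≥6)) (ℕ.≤-trans (ℕ.m≤m+n _ _) (ℕ.≤-reflexive (sym (ring (m ℕ.∸ 5)))))
      where
      ring : ∀ j → 16 * (2 + ((j + 5) * (j + 5) * 4 + (j + 5) * 12 + 7))
                 ≡ suc (50 * (suc (j + 5) * (3 + suc (j + 5)))) + (j * j * 14 + j * 82 + 3)
      ring = ℕ-Solver.solve-∀

  root-decreasing : ∀ n → n ≥ 1 → rootRatioDecreasingAt n
  root-decreasing 1 _ = toWitness {a? = S 3 ^ 2 * S 1 ^ 6 ℕ.<? S 2 ^ 6} _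
  root-decreasing 2 _ = toWitness {a? = S 4 ^ 6 * S 2 ^ 12 ℕ.<? S 3 ^ 16} _
  root-decreasing 3 _ = toWitness {a? = S 5 ^ 12 * S 3 ^ 20 ℕ.<? S 4 ^ 30} _
  root-decreasing 4 _ = toWitness {a? = S 6 ^ 20 * S 4 ^ 30 ℕ.<? S 5 ^ 48} _
  root-decreasing 5 _ = toWitness {a? = S 7 ^ 30 * S 5 ^ 42 ℕ.<? S 6 ^ 70} _
  root-decreasing n@(suc (suc (suc (suc (suc (suc _)))))) _ =
    root-decreasing-≥6 n (ℕ.s≤s (ℕ.s≤s (ℕ.s≤s (ℕ.s≤s (ℕ.s≤s (ℕ.s≤s ℕ.z≤n))))))

  -- Estimates behind the two limits

  bernoulli-above : ∀ f k → f ^ k * (f + k) ≤ (1 + f) ^ k * f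
  bernoulli-above f zero    = ℕ.≤-reflexive (cong (1 *_) (ℕ.+-identityʳ f))
  bernoulli-above f (suc k) = begin
    f * f ^ k * (f + (1 + k))                  ≤⟨ ℕ.m≤m+n _ (f ^ k * k) ⟩
    f * f ^ k * (f + (1 + k)) + f ^ k * k      ≡⟨ ring₁ f (f ^ k) k ⟩
    (1 + f) * (f ^ k * (f + k))                ≤⟨ ℕ.*-monoʳ-≤ (1 + f) (bernoulli-above f k) ⟩
    (1 + f) * ((1 + f) ^ k * f)                ≡⟨ ℕ.*-assoc (1 + f) ((1 + f) ^ k) f ⟨
    (1 + f) * (1 + f) ^ k * f                  ∎
    where
    ring₁ : ∀ f p k → f * p * (f + (1 + k)) + p * k ≡ (1 + f) * (p * (f + k))
    ring₁ = ℕ-Solver.solve-∀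

  -- Bernoulli gives (1 + 1/f)^(1+k) ≥ 1 + (1+k)/f, and the hypothesis makes the right side at least
  -- 9.
  ninefold-growth : ∀ f k → 8 * f ≤ 1 + k → 9 * f ^ (1 + k) ≤ (1 + f) ^ (1 + k)
  -- The value 0 does occur: `root-below` is applied to f = d, where d + 1 is the denominator of ε.
  ninefold-growth zero k _ = ℕ.z≤n
  ninefold-growth f@(suc _) k 8f≤1+k = ℕ.*-cancelʳ-≤ _ _ f (begin
    9 * p * f            ≡⟨ ring₁ p f ⟩
    p * (f + 8 * f)      ≤⟨ ℕ.*-monoʳ-≤ p (ℕ.+-monoʳ-≤ f 8f≤1+k) ⟩
    p * (f + (1 + k))    ≤⟨ bernoulli-above f (1 + k) ⟩
    (1 + f) ^ (1 + k) * f ∎)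
    where
    p = f ^ (1 + k)
    ring₁ : ∀ p f → 9 * p * f ≡ p * (f + 8 * f)
    ring₁ = ℕ-Solver.solve-∀

  growth-power : ∀ f n → 8 * f ≤ 1 + n → 9 ^ n * f ^ (n * suc n) ≤ (1 + f) ^ (n * suc n)
  growth-power f n 8f≤1+n = begin
    9 ^ n * f ^ (n * suc n)    ≡⟨ cong (9 ^ n *_) (nested f) ⟩
    9 ^ n * (f ^ suc n) ^ n    ≡⟨ ^-distribʳ-* 9 (f ^ suc n) n ⟨
    (9 * f ^ suc n) ^ n        ≤⟨ ℕ.^-monoˡ-≤ n (ninefold-growth f n 8f≤1+n) ⟩
    ((1 + f) ^ suc n) ^ n      ≡⟨ nested (1 + f) ⟨
    (1 + f) ^ (n * suc n)      ∎
    where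
    nested : ∀ g → g ^ (n * suc n) ≡ (g ^ suc n) ^ n
    nested g = trans (cong (g ^_) (ℕ.*-comm n (suc n))) (sym (ℕ.^-*-assoc g (suc n) n))

  -- The n(n+1)-th power of the root ratio is y^n / x^(n+1). It is below 9^n since y < 9x and x ≥ 1,
  -- and `growth-power` bounds 9^n by a power of (f+2)/(f+1).
  root-above : ∀ f n x y .{{_ : ℕ.NonZero n}} .{{_ : ℕ.NonZero x}} → y < 9 * x → 8 * suc f ≤ 1 + n →
    y ^ n * suc f ^ (n * suc n) < suc (suc f) ^ (n * suc n) * x ^ suc n
  root-above f n x y y<9x 8f≤1+n = begin-strict
    y ^ n * suc f ^ k          <⟨ ℕ.*-monoˡ-< (suc f ^ k) {{ℕ.m^n≢0 (suc f) k}} (ℕ.^-monoˡ-< n y<9x) ⟩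
    (9 * x) ^ n * suc f ^ k    ≡⟨ cong (_* suc f ^ k) (^-distribʳ-* 9 x n) ⟩
    9 ^ n * x ^ n * suc f ^ k  ≡⟨ ring₁ (9 ^ n) (x ^ n) (suc f ^ k) ⟩
    9 ^ n * suc f ^ k * x ^ n  ≤⟨ ℕ.*-mono-≤ (growth-power (suc f) n 8f≤1+n) (ℕ.^-monoʳ-≤ x (ℕ.n≤1+n n)) ⟩
    suc (suc f) ^ k * x ^ suc n    ∎
    where
    k = n * suc n
    ring₁ : ∀ a b c → a * b * c ≡ a * c * b
    ring₁ = ℕ-Solver.solve-∀

  -- Here y^n / x^(n+1) exceeds 1/x ≥ 1/9^n, which by `growth-power` is at least the n(n+1)-th power
  -- of f/(f+1).
  root-below : ∀ f n x y .{{_ : ℕ.NonZero n}} → x ≤ 9 ^ n → x < y → 8 * f ≤ 1 + n →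
    f ^ (n * suc n) * x ^ suc n < y ^ n * suc f ^ (n * suc n)
  root-below f n x y x≤9^n x<y 8f≤1+n = begin-strict
    f ^ k * (x * x ^ n)      ≤⟨ ℕ.*-monoʳ-≤ (f ^ k) (ℕ.*-monoˡ-≤ (x ^ n) x≤9^n) ⟩
    f ^ k * (9 ^ n * x ^ n)  ≡⟨ ring₁ (f ^ k) (9 ^ n) (x ^ n) ⟩
    9 ^ n * f ^ k * x ^ n    ≤⟨ ℕ.*-monoˡ-≤ (x ^ n) (growth-power f n 8f≤1+n) ⟩
    suc f ^ k * x ^ n        <⟨ ℕ.*-monoʳ-< (suc f ^ k) {{ℕ.m^n≢0 (suc f) k}} (ℕ.^-monoˡ-< n x<y) ⟩
    suc f ^ k * y ^ n        ≡⟨ ℕ.*-comm (suc f ^ k) (y ^ n) ⟩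
    y ^ n * suc f ^ k        ∎
    where
    k = n * suc n
    ring₁ : ∀ a b c → a * (b * c) ≡ b * a * c
    ring₁ = ℕ-Solver.solve-∀

  -- The ratio falls short of 9 by at most 18/den, and 18f ≤ m < den makes this less than 1/f.
  deficit-bound : ∀ f m → 18 * f ≤ m → 9 * (f * S (suc m)) < f * S (suc (suc m)) + S (suc m)
  deficit-bound f m 18f≤m = ℕ.*-cancelˡ-< (den m) _ _ (begin-strict
    den m * (9 * (f * x))          ≡⟨ ring₁ (den m) f x ⟩
    f * (9 * den m * x)            ≤⟨ ℕ.*-monoʳ-≤ f (9S-bound m) ⟩
    f * (den m * y + 18 * x)       ≡⟨ ring₂ f (den m) y x ⟩
    den m * (f * y) + 18 * f * x   <⟨ ℕ.+-monoʳ-< (den m * (f * y)) (ℕ.*-monoˡ-< x {{S-nonZero (suc m)}} (ℕ.≤-<-trans 18f≤m (m<den m))) ⟩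
    den m * (f * y) + den m * x    ≡⟨ ℕ.*-distribˡ-+ (den m) (f * y) x ⟨
    den m * (f * y + x)            ∎)
    where
    x = S (suc m)
    y = S (suc (suc m))
    ring₁ : ∀ d f x → d * (9 * (f * x)) ≡ f * (9 * d * x)
    ring₁ = ℕ-Solver.solve-∀
    ring₂ : ∀ f d y x → f * (d * y + 18 * x) ≡ d * (f * y) + 18 * f * x
    ring₂ = ℕ-Solver.solve-∀

-- Transfer to the rationals

open import Data.Rational using (ℚ; _<_; _+_; _-_; ∣_∣; 0ℚ; 1ℚ; _/_)
open import Data.Rational as ℚ using (mkℚ; _≤_; _*_; -_; toℚᵘ)

ι : ℕ → ℚ
ι n = + n / 1

-- `_/_` divides by a gcd that does not compute for a variable numerator, so the laws of `ι` are
-- verified on unnormalised fractions.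
ιᵘ : ∀ n → toℚᵘ (ι n) ℚᵘ.≃ mkℚᵘ (+ n) 0
ιᵘ n = ℚ.toℚᵘ-fromℚᵘ (mkℚᵘ (+ n) 0)

ι-homo-* : ∀ m n → ι (m ℕ.* n) ≡ ι m * ι n
ι-homo-* m n = ℚ.toℚᵘ-injective (begin-equality
  toℚᵘ (ι (m ℕ.* n))                ≃⟨ ιᵘ (m ℕ.* n) ⟩
  mkℚᵘ (+ (m ℕ.* n)) 0              ≃⟨ *≡* (cong (ℤ._* + 1) (ℤ.pos-* m n)) ⟩
  mkℚᵘ (+ m) 0 ℚᵘ.* mkℚᵘ (+ n) 0    ≃⟨ ℚᵘ.*-cong (ιᵘ m) (ιᵘ n) ⟨
  toℚᵘ (ι m) ℚᵘ.* toℚᵘ (ι n)        ≃⟨ ℚ.toℚᵘ-homo-* (ι m) (ι n) ⟨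
  toℚᵘ (ι m * ι n)                  ∎)
  where open ℚᵘ.≤-Reasoning

ι-homo-+ : ∀ m n → ι (m ℕ.+ n) ≡ ι m + ι n
ι-homo-+ m n = ℚ.toℚᵘ-injective (begin-equality
  toℚᵘ (ι (m ℕ.+ n))                ≃⟨ ιᵘ (m ℕ.+ n) ⟩
  mkℚᵘ (+ (m ℕ.+ n)) 0              ≃⟨ *≡* (cong (ℤ._* + 1) (sym (cong₂ ℤ._+_ (ℤ.*-identityʳ (+ m)) (ℤ.*-identityʳ (+ n))))) ⟩
  mkℚᵘ (+ m) 0 ℚᵘ.+ mkℚᵘ (+ n) 0    ≃⟨ ℚᵘ.+-cong (ιᵘ m) (ιᵘ n) ⟨
  toℚᵘ (ι m) ℚᵘ.+ toℚᵘ (ι n)        ≃⟨ ℚ.toℚᵘ-homo-+ (ι m) (ι n) ⟨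
  toℚᵘ (ι m + ι n)                  ∎)
  where open ℚᵘ.≤-Reasoning

ι-mono-≤ : ∀ {m n} → m ℕ.≤ n → ι m ≤ ι n
ι-mono-≤ {m} {n} m≤n = ℚ.toℚᵘ-cancel-≤ (begin
  toℚᵘ (ι m)    ≃⟨ ιᵘ m ⟩
  mkℚᵘ (+ m) 0  ≤⟨ *≤* (ℤ.*-monoʳ-≤-nonNeg (+ 1) (ℤ.+≤+ m≤n)) ⟩
  mkℚᵘ (+ n) 0  ≃⟨ ιᵘ n ⟨
  toℚᵘ (ι n)    ∎)
  where open ℚᵘ.≤-Reasoning

ι-mono-< : ∀ {m n} → m ℕ.< n → ι m < ι n
ι-mono-< {m} {n} m<n = ℚ.toℚᵘ-cancel-< (begin-strict
  toℚᵘ (ι m)    ≃⟨ ιᵘ m ⟩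
  mkℚᵘ (+ m) 0  <⟨ *<* (ℤ.*-monoʳ-<-pos (+ 1) (ℤ.+<+ m<n)) ⟩
  mkℚᵘ (+ n) 0  ≃⟨ ιᵘ n ⟨
  toℚᵘ (ι n)    ∎)
  where open ℚᵘ.≤-Reasoning

ι-nonNeg : ∀ n → ℚ.NonNegative (ι n)
ι-nonNeg n = ℚ.normalize-nonNeg n 1

/-*-denominator : ∀ m n .{{_ : ℕ.NonZero n}} → (+ m / n) * ι n ≡ ι m
/-*-denominator m n@(suc n-1) = ℚ.toℚᵘ-injective (begin-equality
  toℚᵘ ((+ m / n) * ι n)                ≃⟨ ℚ.toℚᵘ-homo-* (+ m / n) (ι n) ⟩
  toℚᵘ (+ m / n) ℚᵘ.* toℚᵘ (ι n)        ≃⟨ ℚᵘ.*-cong (ℚ.toℚᵘ-fromℚᵘ (mkℚᵘ (+ m) n-1)) (ιᵘ n) ⟩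
  mkℚᵘ (+ m) n-1 ℚᵘ.* mkℚᵘ (+ n) 0      ≃⟨ *≡* (ℤ.*-assoc (+ m) (+ n) (+ 1)) ⟩
  mkℚᵘ (+ m) 0                          ≃⟨ ιᵘ m ⟨
  toℚᵘ (ι m)                            ∎)
  where open ℚᵘ.≤-Reasoning

ratio-*-S : ∀ n → ratio n * ι (S n) ≡ ι (S (suc n))
ratio-*-S n = /-*-denominator (S (suc n)) (S n) {{S-nonZero n}}

-- The witness comes from the denominator of ε: multiplying by it leaves the numerator, a positive
-- integer.
archimedean : ∀ ε → 0ℚ < ε → ∃[ d ] (1ℚ ≤ ε * ι (suc d))
archimedean ε@(mkℚ (+ suc e) d c) _ = d , (begin
  ι 1                            ≤⟨ ι-mono-≤ {1} {suc e} (ℕ.s≤s ℕ.z≤n) ⟩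
  ι (suc e)                      ≡⟨ /-*-denominator (suc e) (suc d) ⟨
  (+ suc e / suc d) * ι (suc d)  ≡⟨ cong (_* ι (suc d)) (ℚ.↥p/↧p≡p ε) ⟩
  ε * ι (suc d)                  ∎)
  where open ℚ.≤-Reasoning
archimedean (mkℚ (+ zero) d c) (ℚ.*<* (ℤ.+<+ ()))
archimedean (mkℚ -[1+ e ] d c) (ℚ.*<* ())

open ℚ.≤-Reasoning

ratio-increasing : ∀ m → ratio (suc m) < ratio (suc (suc m))
ratio-increasing m = ℚ.*-cancelʳ-<-nonNeg (ι (x ℕ.* y)) {{ι-nonNeg (x ℕ.* y)}} (begin-strict
  r * ι (x ℕ.* y)          ≡⟨ cong (r *_) (ι-homo-* x y) ⟩
  r * (ι x * ι y)          ≡⟨ ℚ.*-assoc r (ι x) (ι y) ⟨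
  r * ι x * ι y            ≡⟨ cong (_* ι y) (ratio-*-S (suc m)) ⟩
  ι y * ι y                ≡⟨ ι-homo-* y y ⟨
  ι (y ℕ.* y)              <⟨ ι-mono-< (S-log-convex m) ⟩
  ι (x ℕ.* z)              ≡⟨ ι-homo-* x z ⟩
  ι x * ι z                ≡⟨ cong (ι x *_) (ratio-*-S (suc (suc m))) ⟨
  ι x * (r′ * ι y)         ≡⟨ ℚ.*-assoc (ι x) r′ (ι y) ⟨
  ι x * r′ * ι y           ≡⟨ cong (_* ι y) (ℚ.*-comm (ι x) r′) ⟩
  r′ * ι x * ι y           ≡⟨ ℚ.*-assoc r′ (ι x) (ι y) ⟩
  r′ * (ι x * ι y)         ≡⟨ cong (r′ *_) (ι-homo-* x y) ⟨
  r′ * ι (x ℕ.* y)         ∎)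
  where
  x = S (suc m)
  y = S (suc (suc m))
  z = S (suc (suc (suc m)))
  r = ratio (suc m)
  r′ = ratio (suc (suc m))

ratio<9 : ∀ m → ratio (suc m) < ι 9
ratio<9 m = ℚ.*-cancelʳ-<-nonNeg (ι x) {{ι-nonNeg x}} (begin-strict
  ratio (suc m) * ι x    ≡⟨ ratio-*-S (suc m) ⟩
  ι (S (suc (suc m)))          <⟨ ι-mono-< (S-suc<9S (suc m)) ⟩
  ι (9 ℕ.* x)              ≡⟨ ι-homo-* 9 x ⟩
  ι 9 * ι x                ∎)
  where x = S (suc m)

9<ratio+ε : ∀ ε f → 1ℚ ≤ ε * ι f → ∀ m → 18 ℕ.* f ℕ.≤ m → ι 9 < ratio (suc m) + ε
9<ratio+ε ε f 1≤εf m 18f≤m = ℚ.*-cancelʳ-<-nonNeg (ι (f ℕ.* x)) {{ι-nonNeg (f ℕ.* x)}} (begin-strict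
  ι 9 * ι (f ℕ.* x)                        ≡⟨ ι-homo-* 9 (f ℕ.* x) ⟨
  ι (9 ℕ.* (f ℕ.* x))                      <⟨ ι-mono-< (deficit-bound f m 18f≤m) ⟩
  ι (f ℕ.* y ℕ.+ x)                        ≡⟨ ι-homo-+ (f ℕ.* y) x ⟩
  ι (f ℕ.* y) + ι x                        ≡⟨ cong₂ _+_ (ι-homo-* f y) (sym (ℚ.*-identityˡ (ι x))) ⟩
  ι f * ι y + 1ℚ * ι x                     ≤⟨ ℚ.+-monoʳ-≤ (ι f * ι y) (ℚ.*-monoʳ-≤-nonNeg (ι x) {{ι-nonNeg x}} 1≤εf) ⟩
  ι f * ι y + ε * ι f * ι x                ≡⟨ cong (λ t → ι f * t + ε * ι f * ι x) (ratio-*-S (suc m)) ⟨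
  ι f * (r * ι x) + ε * ι f * ι x          ≡⟨ ring (ι f) r (ι x) ε ⟩
  (r + ε) * (ι f * ι x)                    ≡⟨ cong ((r + ε) *_) (ι-homo-* f x) ⟨
  (r + ε) * ι (f ℕ.* x)                    ∎)
  where
  x = S (suc m)
  y = S (suc (suc m))
  r = ratio (suc m)
  open +-*-Solver
  ring : ∀ f r x e → f * (r * x) + e * f * x ≡ (r + e) * (f * x)
  ring = solve 4 (λ f r x e → f :* (r :* x) :+ e :* f :* x := (r :+ e) :* (f :* x)) refl

∣p-q∣<ε : ∀ {p q ε} → p < q → q < p + ε → 0ℚ < ε → ∣ p - q ∣ < ε
∣p-q∣<ε {p} {q} {ε} p<q q<p+ε 0<ε with ℚ.∣p∣≡p∨∣p∣≡-p (p - q)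
... | inj₁ eq = begin-strict
  ∣ p - q ∣   ≡⟨ eq ⟩
  p - q       <⟨ ℚ.+-monoˡ-< (- q) p<q ⟩
  q - q       ≡⟨ ℚ.+-inverseʳ q ⟩
  0ℚ          <⟨ 0<ε ⟩
  ε           ∎
... | inj₂ eq = begin-strict
  ∣ p - q ∣   ≡⟨ eq ⟩
  - (p - q)   ≡⟨ solve 2 (λ p q → :- (p :- q) := q :- p) refl p q ⟩
  q - p       <⟨ ℚ.+-monoˡ-< (- p) q<p+ε ⟩
  p + ε - p   ≡⟨ solve 2 (λ p e → p :+ e :- p := e) refl p ε ⟩
  ε           ∎
  where open +-*-Solver

ratio-near-9 : ∀ ε f → 0ℚ < ε → 1ℚ ≤ ε * ι f → ∀ n → n ≥ suc (18 ℕ.* f) → ∣ ratio n - ι 9 ∣ < ε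
ratio-near-9 ε f 0<ε 1≤εf (suc m) (ℕ.s≤s 18f≤m) = ∣p-q∣<ε (ratio<9 m) (9<ratio+ε ε f 1≤εf m 18f≤m) 0<ε

ratio→9 : ∀ ε → 0ℚ < ε → ∃[ N ] (∀ n → n ≥ N → ∣ ratio n - ι 9 ∣ < ε)
ratio→9 ε 0<ε =
  let d , 1≤ε[1+d] = archimedean ε 0<ε in
  -- The bounds are indexed by m with n = m + 1, hence the `suc`; 18 is the constant of `9S-bound`.
  suc (18 ℕ.* suc d) , ratio-near-9 ε (suc d) 0<ε 1≤ε[1+d]

*-mono-≤-ι : ∀ {p q} m n → 0ℚ ≤ q → ι m ≤ p → ι n ≤ q → ι (m ℕ.* n) ≤ p * q
*-mono-≤-ι {p} {q} m n 0≤q m≤p n≤q = begin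
  ι (m ℕ.* n)   ≡⟨ ι-homo-* m n ⟩
  ι m * ι n     ≤⟨ ℚ.*-monoˡ-≤-nonNeg (ι m) {{ι-nonNeg m}} n≤q ⟩
  ι m * q       ≤⟨ ℚ.*-monoʳ-≤-nonNeg q {{ℚ.nonNegative 0≤q}} m≤p ⟩
  p * q         ∎

^ℚ-step : ∀ q b k → (q ^ℚ suc k) * ι (b ℕ.^ suc k) ≡ (q * ι b) * ((q ^ℚ k) * ι (b ℕ.^ k))
^ℚ-step q b k = trans (cong ((q ^ℚ suc k) *_) (ι-homo-* b (b ℕ.^ k))) (interchange q (q ^ℚ k) (ι b) (ι (b ℕ.^ k)))

^ℚ-lower : ∀ {q} a b → ι a ≤ q * ι b → ∀ k → ι (a ℕ.^ k) ≤ (q ^ℚ k) * ι (b ℕ.^ k)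
^ℚ-lower a b a≤qb zero = ℚ.≤-refl
^ℚ-lower {q} a b a≤qb (suc k) = begin
  -- The second factor is nonnegative because, by `ih`, it dominates a natural number.
  ι (a ℕ.* a ℕ.^ k)                       ≤⟨ *-mono-≤-ι a (a ℕ.^ k) (ℚ.≤-trans (ℚ.nonNegative⁻¹ _ {{ι-nonNeg (a ℕ.^ k)}}) ih) a≤qb ih ⟩
  (q * ι b) * ((q ^ℚ k) * ι (b ℕ.^ k))    ≡⟨ ^ℚ-step q b k ⟨
  (q ^ℚ suc k) * ι (b ℕ.^ suc k)          ∎
  where ih = ^ℚ-lower a b a≤qb k

^ℚ-nonNeg : ∀ {q} → 0ℚ ≤ q → ∀ k → ℚ.NonNegative (q ^ℚ k)
^ℚ-nonNeg 0≤q zero    = _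
^ℚ-nonNeg {q} 0≤q (suc k) = ℚ.nonNeg*nonNeg⇒nonNeg q {{ℚ.nonNegative 0≤q}} (q ^ℚ k) {{^ℚ-nonNeg 0≤q k}}

^ℚ-upper : ∀ {q} a b → 0ℚ ≤ q → q * ι b ≤ ι a → ∀ k → (q ^ℚ k) * ι (b ℕ.^ k) ≤ ι (a ℕ.^ k)
^ℚ-upper a b 0≤q qb≤a zero = ℚ.≤-refl
^ℚ-upper {q} a b 0≤q qb≤a (suc k) = begin
  (q ^ℚ suc k) * ι (b ℕ.^ suc k)          ≡⟨ ^ℚ-step q b k ⟩
  (q * ι b) * t                           ≤⟨ ℚ.*-monoʳ-≤-nonNeg t {{nonNeg}} qb≤a ⟩
  ι a * t                                 ≤⟨ ℚ.*-monoˡ-≤-nonNeg (ι a) {{ι-nonNeg a}} (^ℚ-upper a b 0≤q qb≤a k) ⟩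
  ι a * ι (a ℕ.^ k)                       ≡⟨ ι-homo-* a (a ℕ.^ k) ⟨
  ι (a ℕ.^ suc k)                         ∎
  where
  t = (q ^ℚ k) * ι (b ℕ.^ k)
  nonNeg : ℚ.NonNegative t
  nonNeg = ℚ.nonNeg*nonNeg⇒nonNeg (q ^ℚ k) {{^ℚ-nonNeg 0≤q k}} (ι (b ℕ.^ k)) {{ι-nonNeg (b ℕ.^ k)}}

-- Replacing q by a fraction a/b below it and moving b^k across leaves a comparison of natural
-- numbers.
^ℚ-<-scaled : ∀ {q} a b → ι a ≤ q * ι b → ∀ k X Y → Y ℕ.* b ℕ.^ k ℕ.< a ℕ.^ k ℕ.* X →
  + Y / 1 < (q ^ℚ k) * (+ X / 1)
^ℚ-<-scaled {q} a b a≤qb k X Y lt = ℚ.*-cancelʳ-<-nonNeg (ι (b ℕ.^ k)) {{ι-nonNeg (b ℕ.^ k)}} (begin-strict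
  ι Y * ι (b ℕ.^ k)                  ≡⟨ ι-homo-* Y (b ℕ.^ k) ⟨
  ι (Y ℕ.* b ℕ.^ k)                  <⟨ ι-mono-< lt ⟩
  ι (a ℕ.^ k ℕ.* X)                  ≡⟨ ι-homo-* (a ℕ.^ k) X ⟩
  ι (a ℕ.^ k) * ι X                  ≤⟨ ℚ.*-monoʳ-≤-nonNeg (ι X) {{ι-nonNeg X}} (^ℚ-lower a b a≤qb k) ⟩
  (q ^ℚ k) * ι (b ℕ.^ k) * ι X       ≡⟨ xy∙z≈xz∙y (q ^ℚ k) (ι (b ℕ.^ k)) (ι X) ⟩
  (q ^ℚ k) * ι X * ι (b ℕ.^ k)       ∎)

^ℚ->-scaled : ∀ {q} a b → 0ℚ ≤ q → q * ι b ≤ ι a → ∀ k X Y → a ℕ.^ k ℕ.* X ℕ.< Y ℕ.* b ℕ.^ k →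
  (q ^ℚ k) * (+ X / 1) < + Y / 1
^ℚ->-scaled {q} a b 0≤q qb≤a k X Y lt = ℚ.*-cancelʳ-<-nonNeg (ι (b ℕ.^ k)) {{ι-nonNeg (b ℕ.^ k)}} (begin-strict
  (q ^ℚ k) * ι X * ι (b ℕ.^ k)       ≡⟨ xy∙z≈xz∙y (q ^ℚ k) (ι X) (ι (b ℕ.^ k)) ⟩
  (q ^ℚ k) * ι (b ℕ.^ k) * ι X       ≤⟨ ℚ.*-monoʳ-≤-nonNeg (ι X) {{ι-nonNeg X}} (^ℚ-upper a b 0≤q qb≤a k) ⟩
  ι (a ℕ.^ k) * ι X                  ≡⟨ ι-homo-* (a ℕ.^ k) X ⟨
  ι (a ℕ.^ k ℕ.* X)                  <⟨ ι-mono-< lt ⟩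
  ι (Y ℕ.* b ℕ.^ k)                  ≡⟨ ι-homo-* Y (b ℕ.^ k) ⟩
  ι Y * ι (b ℕ.^ k)                  ∎)

-- With f = d + 1 and ε ≥ 1/f, the fractions (f+1)/f and d/f lie between 1 - ε and 1 + ε and stand
-- in for these endpoints.
module _ {ε : ℚ} (0<ε : 0ℚ < ε) (d : ℕ) (1≤ε[1+d] : 1ℚ ≤ ε * ι (suc d)) where
  private
    f = suc d

    0<1+ε : 0ℚ < 1ℚ + ε
    0<1+ε = ℚ.+-mono-< {0ℚ} {1ℚ} (ι-mono-< {0} {1} (ℕ.s≤s ℕ.z≤n)) 0<ε

    1+f≤[1+ε]f : ι (suc f) ≤ (1ℚ + ε) * ι f
    1+f≤[1+ε]f = begin
      ι (suc f)            ≡⟨ ι-homo-+ 1 f ⟩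
      1ℚ + ι f             ≤⟨ ℚ.+-monoˡ-≤ (ι f) 1≤ε[1+d] ⟩
      ε * ι f + ι f        ≡⟨ ring ε (ι f) ⟩
      (1ℚ + ε) * ι f       ∎
      where
      open +-*-Solver
      ring : ∀ e f → e * f + f ≡ (1ℚ + e) * f
      ring = solve 2 (λ e f → e :* f :+ f := (con 1ℚ :+ e) :* f) refl

    [1-ε]f≤d : (1ℚ - ε) * ι f ≤ ι d
    [1-ε]f≤d = begin
      (1ℚ - ε) * ι f       ≡⟨ ring₁ ε (ι f) ⟩
      ι f - ε * ι f        ≤⟨ ℚ.+-monoʳ-≤ (ι f) (ℚ.neg-antimono-≤ 1≤ε[1+d]) ⟩
      ι f - 1ℚ             ≡⟨ cong (_- 1ℚ) (ι-homo-+ 1 d) ⟩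
      1ℚ + ι d - 1ℚ        ≡⟨ ring₂ (ι d) ⟩
      ι d                  ∎
      where
      open +-*-Solver
      ring₁ : ∀ e f → (1ℚ - e) * f ≡ f - e * f
      ring₁ = solve 2 (λ e f → (con 1ℚ :- e) :* f := f :- e :* f) refl
      ring₂ : ∀ d → 1ℚ + d - 1ℚ ≡ d
      ring₂ = solve 1 (λ d → con 1ℚ :+ d :- con 1ℚ := d) refl

  rootRatio-near-1 : ∀ n → n ≥ 6 → 8 ℕ.* suc d ℕ.≤ suc n → ((1ℚ - ε) <rootRatio n) × rootRatio< n (1ℚ + ε)
  rootRatio-near-1 n n≥6 8f≤1+n = below ((1ℚ - ε) ℚ.≤? 0ℚ) , above
    where
    instance
      n≢0 : ℕ.NonZero n
      n≢0 = ℕ.>-nonZero (ℕ.≤-trans (ℕ.s≤s ℕ.z≤n) n≥6)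

    above : rootRatio< n (1ℚ + ε)
    above = 0<1+ε , ^ℚ-<-scaled (suc f) f 1+f≤[1+ε]f (n ℕ.* suc n) (S n ℕ.^ suc n) (S (suc n) ℕ.^ n)
      (root-above d n (S n) (S (suc n)) {{n≢0}} {{S-nonZero n}} (S-suc<9S n) 8f≤1+n)

    below : Dec (1ℚ - ε ≤ 0ℚ) → (1ℚ - ε) <rootRatio n
    below (yes 1-ε≤0) = inj₁ 1-ε≤0
    below (no 1-ε≰0)  = inj₂ (^ℚ->-scaled d f (ℚ.<⇒≤ (ℚ.≰⇒> 1-ε≰0)) [1-ε]f≤d (n ℕ.* suc n) (S n ℕ.^ suc n) (S (suc n) ℕ.^ n)
      (root-below d n (S n) (S (suc n)) (S≤9^n n≥6) (S-increasing n)
        (ℕ.≤-trans (ℕ.*-monoʳ-≤ 8 (ℕ.n≤1+n d)) 8f≤1+n)))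

rootRatio→1 : ∀ ε → 0ℚ < ε →
  ∃[ N ] (∀ n → n ≥ N → n ≥ 1 → ((1ℚ - ε) <rootRatio n) × rootRatio< n (1ℚ + ε))
rootRatio→1 ε 0<ε =
  let d , 1≤ε[1+d] = archimedean ε 0<ε in
  -- 6 is for S(n) ≤ 9^n, and 8(d+1) for the ninefold growth of (1 + 1/f)^(n+1).
  6 ℕ.+ 8 ℕ.* suc d , λ n n≥N _ → rootRatio-near-1 0<ε d 1≤ε[1+d] n
    (ℕ.≤-trans (ℕ.m≤m+n 6 (8 ℕ.* suc d)) n≥N)
    (ℕ.≤-trans (ℕ.m≤n+m (8 ℕ.* suc d) 6) (ℕ.m≤n⇒m≤1+n n≥N))

theorem1p2 : ((n : ℕ) → n ≥ 3 → ratio n < ratio (suc n))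
    × ((ε : ℚ) → 0ℚ < ε → ∃[ N ] ((n : ℕ) → n ≥ N → ∣ ratio n - (+ 9) / 1 ∣ < ε))
    × ((n : ℕ) → n ≥ 1 → rootRatioDecreasingAt n)
    × ((ε : ℚ) → 0ℚ < ε → ∃[ N ] ((n : ℕ) → n ≥ N → n ≥ 1 → ((1ℚ - ε) <rootRatio n) × rootRatio< n (1ℚ + ε)))
theorem1p2 = (λ { (suc m) _ → ratio-increasing m }) , ratio→9 , root-decreasing , rootRatio→1
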